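{- Let $\mathcal{F}_1 = \{1234,1243,1324,2134,2314,3124\}$, $\mathcal{F}_2 = \{1324,2134,2143,2314,3124,3214\}$ and $\mathcal{F}_3 = \{1342,2341,2413,2431,3142,3241\}$. For every $n\ge 1$ and every $i\in\{1,2,3\}$, the number of permutations of $\{1,\dots,n\}$ avoiding every pattern in $\mathcal{F}_i$ equals the number of nonsingular similarity relations on $\{1,\dots,n+1\}$.
   Context: A permutation $\pi$ of $\{1,\dots,n\}$ contains a pattern $\tau$ (a permutation of $\{1,\dots,k\}$) if there are indices $i_1<\dots<i_k$ such that $\pi(i_a)<\pi(i_b)$ if and only if $\tau(a)<\tau(b)$; it avoids $\tau$ otherwise. $S_n(\mathcal{E})$ denotes the set of permutations of $\{1,\dots,n\}$ avoiding every pattern in the set $\mathcal{E}$. A similarity relation on $\{1,\dots,m\}$ is a reflexive, symmetric binary relation $R$ such that $x<y<z$ and $xRz$ imply $xRy$ and $yRz$. It is nonsingular if for every $x$ there is $y\neq x$ with $xRy$. (These numbers are the Fine numbers $1,2,6,18,57,\dots$ for $n=1,2,3,\dots$.) -}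

module Defs where

open import Data.Nat using (ℕ; suc; _<_)
open import Data.Fin using (Fin; toℕ; _<?_)
open import Data.Fin.Properties using (_≟_)
open import Data.Vec using (Vec; lookup)
open import Data.Vec.Functional using () renaming (Vector to FVec)
open import Data.List using (List; []; _∷_)
open import Data.Product using (Σ; _×_; ∃)
open import Data.Bool using (Bool; true; false; T)
open import Relation.Binary.PropositionalEquality using (_≡_; _≢_)
open import Relation.Nullary using (¬_)
open import Data.List using (length)
open import Data.List.Relation.Unary.Unique.Propositional using (Unique)
open import Data.List.Membership.Propositional using (_∈_)

-- A permutation of {1..n} in one-line notation: a vector of length n
-- whose entries are pairwise distinct (hence a bijection of Fin n).
IsPerm : ∀ {n} → Vec (Fin n) n → Set
IsPerm {n} v = ∀ (i j : Fin n) → lookup v i ≡ lookup v j → i ≡ j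

Perm : ℕ → Set
Perm n = Σ (Vec (Fin n) n) IsPerm

Contains : ∀ {n k} → Vec (Fin n) n → Vec (Fin k) k → Set
Contains {n} {k} π τ =
  Σ (Fin k → Fin n) λ ι →
    (∀ (a b : Fin k) → toℕ a < toℕ b → toℕ (ι a) < toℕ (ι b)) ×
    (∀ (a b : Fin k) →
       (toℕ (lookup π (ι a)) < toℕ (lookup π (ι b)) → toℕ (lookup τ a) < toℕ (lookup τ b)) ×
       (toℕ (lookup τ a) < toℕ (lookup τ b) → toℕ (lookup π (ι a)) < toℕ (lookup π (ι b))))

Avoids : ∀ {n k} → Vec (Fin n) n → Vec (Fin k) k → Set
Avoids π τ = ¬ Contains π τ

AvoidsAll : ∀ {n} → Vec (Fin n) n → List (Vec (Fin 4) 4) → Set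
AvoidsAll π [] = Data.Unit.⊤ where import Data.Unit
AvoidsAll π (τ ∷ τs) = Avoids π τ × AvoidsAll π τs

InAv : ∀ {n} → List (Vec (Fin 4) 4) → Vec (Fin n) n → Set
InAv E π = IsPerm π × AvoidsAll π E

-- Binary relations on {1..m}, represented by their Boolean adjacency matrix
-- (so relations are finite data and equality is the expected one).
Rel : ℕ → Set
Rel m = Vec (Vec Bool m) m

_R⟨_,_⟩ : ∀ {m} → Rel m → Fin m → Fin m → Set
R R⟨ x , y ⟩ = T (lookup (lookup R x) y)

IsSimilarity : ∀ {m} → Rel m → Set
IsSimilarity {m} R =
  (∀ x → R R⟨ x , x ⟩) ×
  (∀ x y → R R⟨ x , y ⟩ → R R⟨ y , x ⟩) ×
  (∀ x y z → toℕ x < toℕ y → toℕ y < toℕ z → R R⟨ x , z ⟩ →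
     R R⟨ x , y ⟩ × R R⟨ y , z ⟩)

IsNonsingular : ∀ {m} → Rel m → Set
IsNonsingular {m} R = ∀ x → ∃ λ y → (y ≢ x) × R R⟨ x , y ⟩

IsNSSim : ∀ {m} → Rel m → Set
IsNSSim R = IsSimilarity R × IsNonsingular R

HasCard : {A : Set} → (A → Set) → ℕ → Set
HasCard {A} P k = Σ (List A) λ xs →
  Unique xs × (length xs ≡ k) × (∀ x → (x ∈ xs → P x) × (P x → x ∈ xs))

{-# OPTIONS --safe #-}
module Submission where

open import Defs
open import Data.Bool using (Bool; true; false; T; if_then_else_)
open import Data.Bool.Properties using (T?)
open import Data.Empty using (⊥; ⊥-elim)
open import Data.Fin using (Fin; zero; suc; toℕ; fromℕ; fromℕ<; inject₁; punchIn; punchOut; lower₁)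
open import Data.Fin.Patterns using (0F; 1F; 2F; 3F)
open import Data.Fin.Properties as Fin using (toℕ<n; toℕ-injective; toℕ-fromℕ; toℕ-fromℕ<; toℕ-inject₁; toℕ-lower₁; suc-injective; punchIn-injective; punchInᵢ≢i; punchIn-punchOut; punchIn-mono-≤; punchIn-cancel-≤; any?; injective⇒existsPivot)
open import Data.List using (List; []; _∷_; _++_; map; concatMap; filter; length; tabulate; upTo; applyUpTo; allFin)
open import Data.List.Membership.Propositional using (_∈_)
open import Data.List.Membership.Propositional.Properties using (∈-map⁺; ∈-map⁻; ∈-filter⁺; ∈-filter⁻; ∈-++⁺ˡ; ∈-++⁺ʳ; ∈-upTo⁺; ∈-upTo⁻; ∈-allFin)
open import Data.List.Properties using (map-++; map-∘; map-id; map-tabulate; length-map)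
open import Data.List.Relation.Unary.All as All using (All; []; _∷_)
import Data.List.Relation.Unary.All.Properties as All
open import Data.List.Relation.Unary.AllPairs using ([]; _∷_)
import Data.List.Relation.Unary.AllPairs.Properties as AllPairs
open import Data.List.Relation.Unary.Any using (here; there)
open import Data.List.Relation.Unary.Unique.Propositional using (Unique)
import Data.List.Relation.Unary.Unique.Propositional.Properties as Unique
open import Data.Nat using (ℕ; zero; suc; _+_; _≤_; _<_; _>_; _≥_; _<ᵇ_; _≤ᵇ_; _<?_; _≤?_; z≤n; s≤s; s≤s⁻¹)
open import Data.Nat.ListAction using (sum)
open import Data.Nat.ListAction.Properties using (sum-++)
open import Data.Nat.Properties as ℕ using (≤-trans; <-trans; <-≤-trans; ≤-<-trans; <-irrefl; <-asym; ≮⇒≥; ≰⇒>; <⇒≱; <⇒≤; ≤-refl; ≤-reflexive; ≤-antisym; <ᵇ⇒<; ≤ᵇ⇒≤; ≤⇒≤ᵇ; n≤1+n)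
open import Data.Product using (Σ; ∃; _×_; _,_; proj₁; proj₂)
open import Data.Sum using (_⊎_; inj₁; inj₂; [_,_])
open import Data.Unit using (⊤; tt)
open import Data.Vec using (Vec; []; _∷_; lookup; insertAt) renaming (map to mapᵛ; tabulate to tabulateᵛ)
open import Data.Vec.Properties using (lookup∘tabulate; tabulate∘lookup; tabulate-cong; lookup-map; insertAt-lookup; insertAt-punchIn)
open import Function using (_∘_; id; _⇔_; mk⇔; Equivalence)
open import Relation.Binary using (tri<; tri≈; tri>)
open import Relation.Binary.PropositionalEquality hiding ([_])
open import Relation.Nullary using (¬_; yes; no)
open Equivalence using (to; from)

-- Deleting the maximum makes each of the three classes a tree. Below a permutation, the maximum may be
-- inserted at its m + 1 "normal" positions, whose k-th child again has k + 2 normal positions, and sometimes at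
-- one further special position, which exists exactly when the permutation arose by insertion at the 0-th
-- normal position. So all three trees follow one succession rule,
--   (m) → (1⋆) (2) … (m + 1),   (1⋆) → (1) (1⋆) (2),   with root (1).
-- Deleting the first vertex of a similarity relation gives a tree in which a relation is labelled by the number
-- d of later vertices linked to its first vertex, with rule (d) → (0) (1) … (d + 1); nonsingularity
-- prunes this to (0) → (1) and finally discards the label 0. Contracting (d) → (0) → (1) turns one rule into the
-- other: writing t and u for the number of descendants, t (1⋆) = u (0) + u (1) and t (m) = u (m) in every generation.

-- The special position comes from insertions near the front. Each forbidden pattern, with its 4 set
-- apart, restricts triples of old entries around the place where the maximum enters. Once enough
-- entries stand to the left of that place, these restrictions force one shape: a decreasing prefix,
-- an increasing prefix or a cut. With exactly two entries on the left (one for the third class)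
-- most of the patterns do not fit, and those that do leave an alternative: the old maximum stands
-- at one fixed place. That place is the 0-th normal position, so the alternative is created by an
-- insertion there. It is lost after one use, because the new maximum then stands elsewhere. The
-- numbering of the normal positions is chosen to make this true and to let the k-th insertion keep
-- the right number of them. No bijection between permutations and relations is built. The list of
-- labels of a generation is computed from the root label alone, so only descendant counts of labels
-- have to be compared.

record Enumeration {A L : Set} (Label : A → L → Set) (Q : A → Set) (ls : List L) : Set where
  field
    list     : List (A × L)
    labels   : map proj₂ list ≡ ls
    sound    : All (λ (x , l) → Q x × Label x l) list
    unique   : Unique (map proj₁ list)
    complete : ∀ {x} → Q x → x ∈ map proj₁ list

  member⇒Q : ∀ {x} → x ∈ map proj₁ list → Q x
  member⇒Q x∈ with _ , xl∈ , refl ← ∈-map⁻ proj₁ x∈ = proj₁ (All.lookup sound xl∈)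

module _ {A L : Set} {Label : A → L → Set} where

  open Enumeration

  empty : {Q : A → Set} → (∀ {x} → Q x → ⊥) → Enumeration Label Q []
  empty ¬Q = record { list = [] ; labels = refl ; sound = [] ; unique = [] ; complete = ⊥-elim ∘ ¬Q }

  union : {Q R S : A → Set} {ls ms : List L} →
          (∀ {x} → Q x → R x → ⊥) → (∀ {x} → Q x → S x) → (∀ {x} → R x → S x) → (∀ {x} → S x → Q x ⊎ R x) →
          Enumeration Label Q ls → Enumeration Label R ms → Enumeration Label S (ls ++ ms)
  union {Q} {R} {S} disjoint Q⇒S R⇒S S⇒Q⊎R e f = record
    { list     = list e ++ list f
    ; labels   = trans (map-++ proj₂ (list e) (list f)) (cong₂ _++_ (labels e) (labels f))
    ; sound    = All.++⁺ (All.map (λ (q , l) → Q⇒S q , l) (sound e)) (All.map (λ (r , l) → R⇒S r , l) (sound f))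
    ; unique   = subst Unique (sym split) (Unique.++⁺ (unique e) (unique f) λ (x∈e , x∈f) → disjoint (member⇒Q e x∈e) (member⇒Q f x∈f))
    ; complete = λ s → subst (_ ∈_) (sym split) (cover (S⇒Q⊎R s))
    }
    where
    split : map proj₁ (list e ++ list f) ≡ map proj₁ (list e) ++ map proj₁ (list f)
    split = map-++ proj₁ (list e) (list f)
    cover : ∀ {x} → Q x ⊎ R x → x ∈ map proj₁ (list e) ++ map proj₁ (list f)
    cover (inj₁ q) = ∈-++⁺ˡ (complete e q)
    cover (inj₂ r) = ∈-++⁺ʳ _ (complete f r)

  -- A tree may grow a class Q larger than the class R to be counted, provided that the label
  -- decides membership in R. For relations this removes those whose first vertex is still isolated.
  card : {Q R : A → Set} {ls : List L} (keep : L → Bool) → Enumeration Label Q ls →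
         (∀ x → R x → Q x) →
         (∀ x {l} → Q x → Label x l → (R x → T (keep l)) × (T (keep l) → R x)) →
         HasCard R (length (filter (T? ∘ keep) ls))
  card {Q} {R} keep e R⇒Q R⇔keep =
    map proj₁ kept ,
    AllPairs.map⁺ (AllPairs.filter⁺ keep? (AllPairs.map⁻ (unique e))) ,
    trans (length-map proj₁ kept) (trans (length-kept (list e)) (cong (length ∘ filter (T? ∘ keep)) (labels e))) ,
    λ x → kept⇒R , R⇒kept
    where
    keep? = λ (xl : A × L) → T? (keep (proj₂ xl))
    kept  = filter keep? (list e)

    length-kept : ∀ xs → length (filter keep? xs) ≡ length (filter (T? ∘ keep) (map proj₂ xs))
    length-kept [] = refl
    length-kept ((_ , l) ∷ xs) with keep l
    ... | true  = cong suc (length-kept xs)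
    ... | false = length-kept xs

    kept⇒R : ∀ {x} → x ∈ map proj₁ kept → R x
    kept⇒R x∈ with (x , l) , xl∈ , refl ← ∈-map⁻ proj₁ x∈
            with xl∈′ , k ← ∈-filter⁻ keep? {xs = list e} xl∈
            with q , g ← All.lookup (sound e) xl∈′ = proj₂ (R⇔keep x q g) k

    R⇒kept : ∀ {x} → R x → x ∈ map proj₁ kept
    R⇒kept r with (x , l) , xl∈ , refl ← ∈-map⁻ proj₁ (complete e (R⇒Q _ r))
         with q , g ← All.lookup (sound e) xl∈ =
         ∈-map⁺ proj₁ (∈-filter⁺ keep? xl∈ (proj₁ (R⇔keep x q g) r))

-- Every object of positive level has exactly one parent (`parent`, `⊲-unique`), so the families
-- listed by `grow` partition the next level.
record GeneratingTree {X : ℕ → Set} {L : Set} (P : ∀ {n} → X n → Set) (Label : ∀ {n} → X n → L → Set) (kids : L → List L) : Set₁ where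
  field
    _⊲_      : ∀ {n} → X n → X (suc n) → Set
    ⊲-unique : ∀ {n} {x x′ : X n} {y} → x ⊲ y → x′ ⊲ y → x ≡ x′
    parent   : ∀ {n} (y : X (suc n)) → P y → ∃ λ x → P x × x ⊲ y
    grow     : ∀ {n} (x : X n) {l} → P x → Label x l → Enumeration Label (λ y → x ⊲ y × P y) (kids l)

  open Enumeration

  grow-all : ∀ {n} (xs : List (X n × L)) → All (λ (x , l) → P x × Label x l) xs → Unique (map proj₁ xs) →
             Enumeration Label (λ y → ∃ λ x → x ∈ map proj₁ xs × x ⊲ y × P y) (concatMap kids (map proj₂ xs))
  grow-all [] [] [] = empty λ ()
  grow-all ((x , l) ∷ xs) ((p , g) ∷ s) (x∉ ∷ u) =
    union (λ { (x⊲y , _) (x′ , x′∈ , x′⊲y , _) → All.lookup x∉ x′∈ (⊲-unique x⊲y x′⊲y) })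
          (λ (x⊲y , q) → x , here refl , x⊲y , q)
          (λ (x′ , x′∈ , r) → x′ , there x′∈ , r)
          (λ { (_ , here refl , r) → inj₁ r ; (x′ , there x′∈ , r) → inj₂ (x′ , x′∈ , r) })
          (grow x p g) (grow-all xs s u)

  next : ∀ {n ls} → Enumeration {X n} Label P ls → Enumeration {X (suc n)} Label P (concatMap kids ls)
  next {ls = ls} e = subst (Enumeration Label P ∘ concatMap kids) (labels e) record
    { list     = list f
    ; labels   = labels f
    ; sound    = All.map (λ ((_ , _ , _ , p) , g) → p , g) (sound f)
    ; unique   = unique f
    ; complete = λ {y} q → let x , p , x⊲y = parent y q in complete f (x , complete e p , x⊲y , q)
    }
    where f = grow-all (list e) (sound e) (unique e)

-- Counting a generation from its labels alone

module _ {L : Set} (kids : L → List L) where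

  generation : ℕ → List L → List L
  generation zero    ls = ls
  generation (suc k) ls = concatMap kids (generation k ls)

  module _ (keep : L → Bool) where

    descendants : ℕ → L → ℕ
    descendants zero    l = if keep l then 1 else 0
    descendants (suc k) l = sum (map (descendants k) (kids l))

    -- `generation` adds children at the last level whereas `descendants` splits off the first one;
    -- `generation-comm` reconciles the two recursions.
    length-generation : ∀ k ls → length (filter (T? ∘ keep) (generation k ls)) ≡ sum (map (descendants k) ls)
    length-generation zero ls = length-kept ls
      where
      length-kept : ∀ ls → length (filter (T? ∘ keep) ls) ≡ sum (map (descendants zero) ls)
      length-kept [] = refl
      length-kept (l ∷ ls) with keep l
      ... | true  = cong suc (length-kept ls)
      ... | false = length-kept ls
    length-generation (suc k) ls = begin
      length (filter (T? ∘ keep) (concatMap kids (generation k ls))) ≡⟨ cong (length ∘ filter (T? ∘ keep)) (generation-comm k ls) ⟩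
      length (filter (T? ∘ keep) (generation k (concatMap kids ls))) ≡⟨ length-generation k (concatMap kids ls) ⟩
      sum (map (descendants k) (concatMap kids ls))                  ≡⟨ sum-concatMap ls ⟩
      sum (map (descendants (suc k)) ls)                             ∎
      where
      open ≡-Reasoning
      generation-comm : ∀ k ls → concatMap kids (generation k ls) ≡ generation k (concatMap kids ls)
      generation-comm zero    ls = refl
      generation-comm (suc k) ls = cong (concatMap kids) (generation-comm k ls)

      sum-concatMap : ∀ ls → sum (map (descendants k) (concatMap kids ls)) ≡ sum (map (descendants (suc k)) ls)
      sum-concatMap [] = refl
      sum-concatMap (l ∷ ls) = begin
        sum (map (descendants k) (kids l ++ concatMap kids ls)) ≡⟨ cong sum (map-++ (descendants k) (kids l) _) ⟩
        sum (map (descendants k) (kids l) ++ map (descendants k) (concatMap kids ls)) ≡⟨ sum-++ (map (descendants k) (kids l)) _ ⟩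
        descendants (suc k) l + sum (map (descendants k) (concatMap kids ls)) ≡⟨ cong (descendants (suc k) l +_) (sum-concatMap ls) ⟩
        descendants (suc k) l + sum (map (descendants (suc k)) ls) ∎

generations : ∀ {X : ℕ → Set} {L : Set} {P : ∀ {n} → X n → Set} {Label : ∀ {n} → X n → L → Set} {kids : L → List L} →
              GeneratingTree {X} P Label kids → ∀ {ls} → Enumeration {X 1} Label P ls →
              ∀ k → Enumeration {X (suc k)} Label P (generation kids k ls)
generations tree e zero    = e
generations tree e (suc k) = GeneratingTree.next tree (generations tree e k)

Unique-map⁺ : ∀ {C A : Set} {f : C → A} {cs : List C} →
              (∀ {c d} → c ∈ cs → d ∈ cs → f c ≡ f d → c ≡ d) → Unique cs → Unique (map f cs)
Unique-map⁺ inj []       = []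
Unique-map⁺ inj (c∉ ∷ u) =
  All.map⁺ (All.tabulate λ d∈ e → All.lookup c∉ d∈ (inj (here refl) (there d∈) e)) ∷
  Unique-map⁺ (λ c∈ d∈ → inj (there c∈) (there d∈)) u

-- Lists the children of one object, parametrised by a link count or by the index of an insertion
-- position. Injectivity is asked on `cs` only, since `extend` does not distinguish link counts
-- beyond the last vertex.
choices : ∀ {A C L : Set} {Label : A → L → Set} {Q : A → Set} (f : C → A) (g : C → L) (cs : List C) → Unique cs →
          (∀ {c d} → c ∈ cs → d ∈ cs → f c ≡ f d → c ≡ d) →
          (∀ {c} → c ∈ cs → Q (f c) × Label (f c) (g c)) →
          (∀ x → Q x → ∃ λ c → c ∈ cs × x ≡ f c) →
          Enumeration Label Q (map g cs)
choices {Label = Label} {Q} f g cs u inj s comp = record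
  { list     = map (λ c → f c , g c) cs
  ; labels   = sym (map-∘ cs)
  ; sound    = All.map⁺ (All.tabulate s)
  ; unique   = subst Unique (map-∘ cs) (Unique-map⁺ inj u)
  ; complete = λ q → let c , c∈ , e = comp _ q in subst₂ _∈_ (sym e) (map-∘ cs) (∈-map⁺ f c∈)
  }

-- Similarity relations grown by a new first vertex

T-ext : ∀ {a b} → (T a → T b) → (T b → T a) → a ≡ b
T-ext {false} {false} _ _ = refl
T-ext {false} {true}  _ g = ⊥-elim (g tt)
T-ext {true}  {false} f _ = ⊥-elim (f tt)
T-ext {true}  {true}  _ _ = refl

lookup-ext : ∀ {A : Set} {n} {xs ys : Vec A n} → (∀ i → lookup xs i ≡ lookup ys i) → xs ≡ ys
lookup-ext {xs = xs} {ys} e = trans (sym (tabulate∘lookup xs)) (trans (tabulate-cong e) (tabulate∘lookup ys))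

entry : ∀ {m} → Rel m → Fin m → Fin m → Bool
entry R x y = lookup (lookup R x) y

entry-ext : ∀ {m} {R S : Rel m} → (∀ x y → entry R x y ≡ entry S x y) → R ≡ S
entry-ext e = lookup-ext λ x → lookup-ext (e x)

fromEntries : ∀ {m} → (Fin m → Fin m → Bool) → Rel m
fromEntries f = tabulateᵛ λ x → tabulateᵛ (f x)

entry-fromEntries : ∀ {m} (f : Fin m → Fin m → Bool) x y → entry (fromEntries f) x y ≡ f x y
entry-fromEntries f x y = trans (cong (λ r → lookup r y) (lookup∘tabulate _ x)) (lookup∘tabulate (f x) y)

-- Vertex 0 is exempt from nonsingularity: it may still be linked to a vertex that is added later.
AlmostNonsingular : ∀ {m} → Rel m → Set
AlmostNonsingular R = IsSimilarity R × (∀ x → 0 < toℕ x → ∃ λ y → (y ≢ x) × R R⟨ x , y ⟩)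

-- By convexity the neighbours of the first vertex form an initial segment, so the last index d
-- stands for the whole row. The bound `d ≤ m` makes d unique.
LinkedUpTo : ∀ {m} → Rel m → ℕ → Set
LinkedUpTo {zero}  R d = ⊥
LinkedUpTo {suc m} R d = d ≤ m × (∀ y → R R⟨ zero , y ⟩ ⇔ toℕ y ≤ d)

LinkedUpTo-unique : ∀ {m} (R : Rel m) {d e} → LinkedUpTo R d → LinkedUpTo R e → d ≡ e
LinkedUpTo-unique {suc m} R r s = ≤-antisym (bound r s) (bound s r)
  where
  bound : ∀ {d e} → LinkedUpTo R d → LinkedUpTo R e → d ≤ e
  bound {e = e} (d≤m , r) (_ , s) = subst (_≤ e) (toℕ-fromℕ< (s≤s d≤m)) (to (s _) (from (r _) (≤-reflexive (toℕ-fromℕ< (s≤s d≤m)))))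

initial-segment : ∀ {m} (f : Fin (suc m) → Bool) → T (f zero) → (∀ {x y} → toℕ x < toℕ y → T (f y) → T (f x)) →
                  ∃ λ d → d ≤ m × (∀ y → T (f y) ⇔ toℕ y ≤ d)
initial-segment {zero} f f0 down = 0 , z≤n , λ { zero → mk⇔ (λ _ → z≤n) (λ _ → f0) }
initial-segment {suc m} f f0 down with f (suc zero) in e
... | false = 0 , z≤n , λ
  { zero          → mk⇔ (λ _ → z≤n) (λ _ → f0)
  ; (suc zero)    → mk⇔ (λ t → ⊥-elim (subst T e t)) λ ()
  ; (suc (suc y)) → mk⇔ (λ t → ⊥-elim (subst T e (down (s≤s (s≤s z≤n)) t))) λ ()
  }
... | true with d , d≤m , h ← initial-segment (f ∘ suc) (subst T (sym e) tt) (down ∘ s≤s) = suc d , s≤s d≤m , λ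
  { zero    → mk⇔ (λ _ → z≤n) (λ _ → f0)
  ; (suc y) → mk⇔ (s≤s ∘ to (h y)) (from (h y) ∘ s≤s⁻¹)
  }

_restricts_ : ∀ {m} → Rel m → Rel (suc m) → Set
R restricts S = ∀ x y → entry S (suc x) (suc y) ≡ entry R x y

extendEntries : ∀ {m} → ℕ → Rel m → Fin (suc m) → Fin (suc m) → Bool
extendEntries d R zero    y       = toℕ y ≤ᵇ d
extendEntries d R (suc x) zero    = suc (toℕ x) ≤ᵇ d
extendEntries d R (suc x) (suc y) = entry R x y

extend : ∀ {m} → ℕ → Rel m → Rel (suc m)
extend d R = fromEntries (extendEntries d R)

extend-restricts : ∀ {m} d (R : Rel m) → R restricts extend d R
extend-restricts d R x y = entry-fromEntries (extendEntries d R) (suc x) (suc y)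

extend-zero : ∀ {m} d (R : Rel m) y → extend d R R⟨ zero , y ⟩ ⇔ toℕ y ≤ d
extend-zero d R y = mk⇔ (λ t → ≤ᵇ⇒≤ _ _ (subst T e t)) (λ le → subst T (sym e) (≤⇒≤ᵇ le))
  where e = entry-fromEntries (extendEntries d R) zero y

-- Convexity passes every link of the new vertex, except the one to its immediate successor, on to
-- the old first vertex; hence at most d + 1 links. If d is 0, the old first vertex has no later
-- neighbour and the new vertex is its last chance to get one, so the count must be exactly 1.
simKids : ℕ → List ℕ
simKids zero    = 1 ∷ []
simKids (suc d) = upTo (suc (suc (suc d)))

simKids-sound : ∀ {d e} → e ∈ simKids d → e ≤ suc d × (d ≡ 0 → e ≡ 1)
simKids-sound {zero}  (here refl) = s≤s z≤n , λ _ → refl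
simKids-sound {suc d} e∈ = s≤s⁻¹ (∈-upTo⁻ e∈) , λ ()

simKids-complete : ∀ {d e} → e ≤ suc d → (d ≡ 0 → 1 ≤ e) → e ∈ simKids d
simKids-complete {zero}  le ge = here (≤-antisym le (ge refl))
simKids-complete {suc d} le ge = ∈-upTo⁺ (s≤s le)

simKids-unique : ∀ d → Unique (simKids d)
simKids-unique zero    = [] ∷ []
simKids-unique (suc d) = Unique.upTo⁺ _

module _ {m} (R : Rel (suc m)) {d : ℕ} (almost : AlmostNonsingular R) (linked : LinkedUpTo R d) where

  private
    reflexive = proj₁ (proj₁ almost)
    symmetric = proj₁ (proj₂ (proj₁ almost))
    convex    = proj₂ (proj₂ (proj₁ almost))

  module _ {e : ℕ} (e∈ : e ∈ simKids d) where

    private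
      S = extend e R

      zero-suc : ∀ {y} → suc (toℕ y) ≤ e → S R⟨ zero , suc y ⟩
      zero-suc {y} le = from (extend-zero e R (suc y)) le

      suc-zero⁺ : ∀ {y} → suc (toℕ y) ≤ e → S R⟨ suc y , zero ⟩
      suc-zero⁺ {y} le = subst T (sym (entry-fromEntries (extendEntries e R) (suc y) zero)) (≤⇒≤ᵇ le)

      suc-zero⁻ : ∀ {y} → S R⟨ suc y , zero ⟩ → suc (toℕ y) ≤ e
      suc-zero⁻ {y} t = ≤ᵇ⇒≤ _ _ (subst T (entry-fromEntries (extendEntries e R) (suc y) zero) t)

      old : ∀ {x y} → R R⟨ x , y ⟩ → S R⟨ suc x , suc y ⟩
      old {x} {y} = subst T (sym (extend-restricts e R x y))

      old⁻ : ∀ {x y} → S R⟨ suc x , suc y ⟩ → R R⟨ x , y ⟩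
      old⁻ {x} {y} = subst T (extend-restricts e R x y)

      e≤1+d : e ≤ suc d
      e≤1+d = proj₁ (simKids-sound {d} e∈)

      refl′ : ∀ x → S R⟨ x , x ⟩
      refl′ zero    = from (extend-zero e R zero) z≤n
      refl′ (suc x) = old (reflexive x)

      sym′ : ∀ x y → S R⟨ x , y ⟩ → S R⟨ y , x ⟩
      sym′ zero    zero    r = r
      sym′ zero    (suc y) r = suc-zero⁺ {y} (to (extend-zero e R (suc y)) r)
      sym′ (suc x) zero    r = zero-suc {x} (suc-zero⁻ {x} r)
      sym′ (suc x) (suc y) r = old (symmetric x y (old⁻ r))

      convex′ : ∀ x y z → toℕ x < toℕ y → toℕ y < toℕ z → S R⟨ x , z ⟩ → S R⟨ x , y ⟩ × S R⟨ y , z ⟩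
      -- As `e ≤ suc d`, each later vertex linked to the new one is already linked to the old first
      -- vertex, and convexity of `R` applies from there.
      convex′ zero (suc y) (suc z) _ y<z r = zero-suc (≤-trans (ℕ.<⇒≤ y<z) z<e) , old (from-zero y y<z)
        where
        z<e = to (extend-zero e R (suc z)) r
        0Rz : R R⟨ zero , z ⟩
        0Rz = from (proj₂ linked z) (s≤s⁻¹ (≤-trans z<e e≤1+d))
        from-zero : ∀ y → suc (toℕ y) < suc (toℕ z) → R R⟨ y , z ⟩
        from-zero zero    _   = 0Rz
        from-zero (suc y) y<z = proj₂ (convex zero (suc y) z (s≤s z≤n) (s≤s⁻¹ y<z) 0Rz)
      convex′ (suc x) (suc y) (suc z) x<y y<z r =
        let r₁ , r₂ = convex x y z (s≤s⁻¹ x<y) (s≤s⁻¹ y<z) (old⁻ r) in old r₁ , old r₂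

      neighbour : ∀ x → 0 < toℕ x → ∃ λ y → (y ≢ x) × S R⟨ x , y ⟩
      neighbour (suc (suc x)) _ =
        let y , y≢x , r = proj₂ almost (suc x) (s≤s z≤n) in suc y , y≢x ∘ suc-injective , old r
      neighbour (suc zero) _ = go d linked (proj₂ (simKids-sound {d} e∈))
        where
        go : ∀ d → LinkedUpTo R d → (d ≡ 0 → e ≡ 1) → ∃ λ y → (y ≢ suc zero) × S R⟨ suc zero , y ⟩
        go zero    _         e≡1 = zero , (λ ()) , suc-zero⁺ (≤-reflexive (sym (e≡1 refl)))
        go (suc d) (s≤s _ , h) _ = suc (suc zero) , (λ ()) , old (from (h (suc zero)) (s≤s z≤n))

    extend-almostNonsingular : AlmostNonsingular S
    extend-almostNonsingular = (refl′ , sym′ , convex′) , neighbour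

    extend-linked : LinkedUpTo S e
    extend-linked = ≤-trans e≤1+d (s≤s (proj₁ linked)) , extend-zero e R

  -- The neighbours of the new vertex form an initial segment by convexity, and its end e, together
  -- with `R`, determines the whole of `S`.
  extension : ∀ S → R restricts S → AlmostNonsingular S → ∃ λ e → e ∈ simKids d × S ≡ extend e R
  extension S R⊲S ((reflS , symS , convS) , nonsing) =
    e , simKids-complete (upper e (proj₁ (proj₂ segment)) h) (lower h) ,
    entry-ext λ x y → trans (same x y) (sym (entry-fromEntries (extendEntries e R) x y))
    where
    down : ∀ {x y} → toℕ x < toℕ y → S R⟨ zero , y ⟩ → S R⟨ zero , x ⟩
    down {zero}  _   _ = reflS zero
    down {suc x} {y} x<y r = proj₁ (convS zero (suc x) y (s≤s z≤n) x<y r)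

    segment = initial-segment (entry S zero) (reflS zero) (λ {x} {y} → down {x} {y})
    e = proj₁ segment
    h = proj₂ (proj₂ segment)

    upper : ∀ e → e ≤ suc m → (∀ y → S R⟨ zero , y ⟩ ⇔ toℕ y ≤ e) → e ≤ suc d
    upper zero          _  _ = z≤n
    upper (suc zero)    _  _ = s≤s z≤n
    -- The farthest neighbour of the new vertex is the old vertex `z`, of index one less. Convexity
    -- through vertex 1, the old first vertex, links that vertex to `z`, which bounds the index of
    -- `z` by d.
    upper (suc (suc e)) e≤ h = s≤s (subst (_≤ d) (toℕ-fromℕ< e≤) (to (proj₂ linked z) 0Rz))
      where
      z = fromℕ< e≤
      0Rz : R R⟨ zero , z ⟩
      0Rz = subst T (R⊲S zero z) (proj₂ (convS zero (suc zero) (suc z) (s≤s z≤n)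
              (s≤s (subst (0 <_) (sym (toℕ-fromℕ< e≤)) (s≤s z≤n)))
              (from (h (suc z)) (s≤s (≤-reflexive (toℕ-fromℕ< e≤))))))

    lower : ∀ {e} → (∀ y → S R⟨ zero , y ⟩ ⇔ toℕ y ≤ e) → d ≡ 0 → 1 ≤ e
    lower h refl with nonsing (suc zero) (s≤s z≤n)
    ... | zero        , _   , r = to (h (suc zero)) (symS (suc zero) zero r)
    ... | suc zero    , z≢1 , _ = ⊥-elim (z≢1 refl)
    ... | suc (suc z) , _   , r with () ← to (proj₂ linked (suc z)) (subst T (R⊲S zero (suc z)) r)

    same : ∀ x y → entry S x y ≡ extendEntries e R x y
    same zero    y       = T-ext (≤⇒≤ᵇ ∘ to (h y)) (from (h y) ∘ ≤ᵇ⇒≤ _ _)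
    same (suc x) zero    = T-ext (≤⇒≤ᵇ ∘ to (h (suc x)) ∘ symS (suc x) zero) (symS zero (suc x) ∘ from (h (suc x)) ∘ ≤ᵇ⇒≤ _ _)
    same (suc x) (suc y) = R⊲S x y

restrict : ∀ {m} → Rel (suc m) → Rel m
restrict S = fromEntries λ x y → entry S (suc x) (suc y)

restrict-restricts : ∀ {m} (S : Rel (suc m)) → restrict S restricts S
restrict-restricts S x y = sym (entry-fromEntries (λ x y → entry S (suc x) (suc y)) x y)

restrict-almostNonsingular : ∀ {m} (S : Rel (suc m)) → AlmostNonsingular S → AlmostNonsingular (restrict S)
restrict-almostNonsingular S ((reflS , symS , convS) , nonsing) =
  ((λ x → r⁺ (reflS (suc x))) ,
   (λ x y r → r⁺ (symS (suc x) (suc y) (r⁻ r))) ,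
   (λ x y z x<y y<z r → let p , q = convS (suc x) (suc y) (suc z) (s≤s x<y) (s≤s y<z) (r⁻ r) in r⁺ p , r⁺ q)) ,
  neighbour
  where
  r⁺ : ∀ {x y} → S R⟨ suc x , suc y ⟩ → restrict S R⟨ x , y ⟩
  r⁺ {x} {y} = subst T (restrict-restricts S x y)
  r⁻ : ∀ {x y} → restrict S R⟨ x , y ⟩ → S R⟨ suc x , suc y ⟩
  r⁻ {x} {y} = subst T (sym (restrict-restricts S x y))
  neighbour : ∀ x → 0 < toℕ x → ∃ λ y → (y ≢ x) × restrict S R⟨ x , y ⟩
  neighbour (suc x) _ with nonsing (suc (suc x)) (s≤s z≤n)
  -- If the neighbour is the deleted vertex, convexity supplies vertex 1, the new first vertex, as a
  -- replacement.
  ... | zero  , _   , r = zero , (λ ()) , r⁺ (symS (suc zero) (suc (suc x)) (proj₂ (convS zero (suc zero) (suc (suc x)) (s≤s z≤n) (s≤s (s≤s z≤n)) (symS _ _ r))))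
  ... | suc y , y≢x , r = y , y≢x ∘ cong suc , r⁺ r

similarityTree : GeneratingTree {Rel} AlmostNonsingular LinkedUpTo simKids
similarityTree = record
  { _⊲_      = _restricts_
  ; ⊲-unique = λ r s → entry-ext λ x y → trans (sym (r x y)) (s x y)
  ; parent   = λ S p → restrict S , restrict-almostNonsingular S p , restrict-restricts S
  ; grow     = grow
  }
  where
  grow : ∀ {m} (R : Rel m) {d} → AlmostNonsingular R → LinkedUpTo R d →
         Enumeration LinkedUpTo (λ S → R restricts S × AlmostNonsingular S) (simKids d)
  grow {suc m} R {d} p l = subst (Enumeration LinkedUpTo _) (map-id (simKids d))
    (choices (λ e → extend e R) id (simKids d) (simKids-unique d)
      (λ {c} {e} c∈ e∈ eq → LinkedUpTo-unique (extend c R) (extend-linked R p l c∈) (subst (λ S → LinkedUpTo S e) (sym eq) (extend-linked R p l e∈)))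
      (λ {e} e∈ → (extend-restricts e R , extend-almostNonsingular R p l e∈) , extend-linked R p l e∈)
      (λ S (r , q) → extension R p l S r q))

one-vertex : Enumeration {Rel 1} LinkedUpTo AlmostNonsingular (0 ∷ [])
one-vertex = record
  { list     = (((true ∷ []) ∷ []) , 0) ∷ []
  ; labels   = refl
  ; sound    = ((((λ { zero → tt }) , (λ { zero zero _ → tt }) , λ { zero zero zero () }) , λ { zero () }) ,
                (z≤n , λ { zero → mk⇔ (λ _ → z≤n) (λ _ → tt) })) ∷ []
  ; unique   = [] ∷ []
  ; complete = λ ((r , _) , _) → here (entry-ext λ { zero zero → T-ext (λ _ → tt) (λ _ → r zero) })
  }

nonzero : ℕ → Bool
nonzero zero    = false
nonzero (suc _) = true

similarity-count : ∀ n → HasCard (IsNSSim {suc n}) (descendants simKids nonzero n 0)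
similarity-count n = subst (HasCard IsNSSim)
  (trans (length-generation simKids nonzero n (0 ∷ [])) (ℕ.+-identityʳ _))
  (card nonzero (generations similarityTree one-vertex n)
    (λ _ (sim , nonsing) → sim , λ x _ → nonsing x) nonsingular⇔)
  where
  nonsingular⇔ : ∀ (R : Rel (suc n)) {d} → AlmostNonsingular R → LinkedUpTo R d → (IsNSSim R → T (nonzero d)) × (T (nonzero d) → IsNSSim R)
  nonsingular⇔ R {zero} _ (_ , h) = (λ (_ , nonsing) → let y , y≢0 , r = nonsing zero in ⊥-elim (y≢0 (is-zero y (to (h y) r)))) , λ ()
    where
    is-zero : ∀ (y : Fin (suc n)) → toℕ y ≤ 0 → y ≡ zero
    is-zero zero _ = refl
  nonsingular⇔ R {suc d} (sim , nonsing) (s≤s _ , h) = (λ _ → tt) , λ _ → sim , λ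
    { zero    → suc zero , (λ ()) , from (h (suc zero)) (s≤s z≤n)
    ; (suc x) → nonsing (suc x) (s≤s z≤n)
    }

-- Permutations grown by a new maximum

infix 25 _!_
_!_ : ∀ {n k} → Vec (Fin n) k → Fin k → ℕ
π ! i = toℕ (lookup π i)

insertMax : ∀ {n} → Vec (Fin n) n → Fin (suc n) → Vec (Fin (suc n)) (suc n)
insertMax {n} π p = insertAt (mapᵛ inject₁ π) p (fromℕ n)

!-new : ∀ {n} (π : Vec (Fin n) n) p → insertMax π p ! p ≡ n
!-new {n} π p = trans (cong toℕ (insertAt-lookup (mapᵛ inject₁ π) p (fromℕ n))) (toℕ-fromℕ n)

!-old : ∀ {n} (π : Vec (Fin n) n) p i → insertMax π p ! punchIn p i ≡ π ! i
!-old {n} π p i = begin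
  toℕ (lookup (insertMax π p) (punchIn p i)) ≡⟨ cong toℕ (insertAt-punchIn (mapᵛ inject₁ π) p (fromℕ n) i) ⟩
  toℕ (lookup (mapᵛ inject₁ π) i)            ≡⟨ cong toℕ (lookup-map i inject₁ π) ⟩
  toℕ (inject₁ (lookup π i))                 ≡⟨ toℕ-inject₁ _ ⟩
  π ! i                                      ∎
  where open ≡-Reasoning

!<n : ∀ {n k} (π : Vec (Fin n) k) i → π ! i < n
!<n π i = toℕ<n (lookup π i)

data Place {n} (p : Fin (suc n)) : Fin (suc n) → Set where
  new : Place p p
  old : ∀ i → Place p (punchIn p i)

place : ∀ {n} (p q : Fin (suc n)) → Place p q
place p q with p Fin.≟ q
... | yes refl = new
... | no p≢q   = subst (Place p) (punchIn-punchOut p≢q) (old (punchOut p≢q))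

punchIn-mono-< : ∀ {n} (p : Fin (suc n)) {i j} → toℕ i < toℕ j → toℕ (punchIn p i) < toℕ (punchIn p j)
punchIn-mono-< p {i} {j} i<j = ≰⇒> (<⇒≱ i<j ∘ punchIn-cancel-≤ p j i)

punchIn-cancel-< : ∀ {n} (p : Fin (suc n)) {i j} → toℕ (punchIn p i) < toℕ (punchIn p j) → toℕ i < toℕ j
punchIn-cancel-< p {i} {j} lt = ≰⇒> (<⇒≱ lt ∘ punchIn-mono-≤ p j i)

punchIn-below : ∀ {n} (p : Fin (suc n)) {i} → toℕ i < toℕ p → toℕ (punchIn p i) ≡ toℕ i
punchIn-below (suc p) {zero}  _   = refl
punchIn-below (suc p) {suc i} i<p = cong suc (punchIn-below p (s≤s⁻¹ i<p))

punchIn-above : ∀ {n} (p : Fin (suc n)) {i} → toℕ p ≤ toℕ i → toℕ (punchIn p i) ≡ suc (toℕ i)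
punchIn-above zero            _   = refl
punchIn-above (suc p) {suc i} p≤i = cong suc (punchIn-above p (s≤s⁻¹ p≤i))

punchIn-increasing : ∀ {n} (p : Fin (suc n)) i → toℕ i ≤ toℕ (punchIn p i)
punchIn-increasing zero    i       = ℕ.n≤1+n _
punchIn-increasing (suc p) zero    = z≤n
punchIn-increasing (suc p) (suc i) = s≤s (punchIn-increasing p i)

old<new⁺ : ∀ {n} (p : Fin (suc n)) {i} → toℕ i < toℕ p → toℕ (punchIn p i) < toℕ p
old<new⁺ p i<p = subst (_< toℕ p) (sym (punchIn-below p i<p)) i<p

new<old⁺ : ∀ {n} (p : Fin (suc n)) {i} → toℕ p ≤ toℕ i → toℕ p < toℕ (punchIn p i)
new<old⁺ p p≤i = subst (toℕ p <_) (sym (punchIn-above p p≤i)) (s≤s p≤i)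

old<new⁻ : ∀ {n} (p : Fin (suc n)) {i} → toℕ (punchIn p i) < toℕ p → toℕ i < toℕ p
old<new⁻ p lt = ≰⇒> (<-asym lt ∘ new<old⁺ p)

new<old⁻ : ∀ {n} (p : Fin (suc n)) {i} → toℕ p < toℕ (punchIn p i) → toℕ p ≤ toℕ i
new<old⁻ p lt = ≮⇒≥ (<-asym lt ∘ old<new⁺ p)

old<max : ∀ {n} (π : Vec (Fin n) n) p i → insertMax π p ! punchIn p i < insertMax π p ! p
old<max π p i = subst₂ _<_ (sym (!-old π p i)) (sym (!-new π p)) (!<n π i)

IsPerm-insertMax⁺ : ∀ {n} {π : Vec (Fin n) n} {p} → IsPerm π → IsPerm (insertMax π p)
IsPerm-insertMax⁺ {n} {π} {p} perm i j e with place p i | place p j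
... | new   | new   = refl
... | new   | old j = ⊥-elim (<-irrefl (cong toℕ (sym e)) (old<max π p j))
... | old i | new   = ⊥-elim (<-irrefl (cong toℕ e) (old<max π p i))
... | old i | old j = cong (punchIn p) (perm i j (toℕ-injective (trans (sym (!-old π p i)) (trans (cong toℕ e) (!-old π p j)))))

IsPerm-insertMax⁻ : ∀ {n} {π : Vec (Fin n) n} {p} → IsPerm (insertMax π p) → IsPerm π
IsPerm-insertMax⁻ {n} {π} {p} perm i j e =
  punchIn-injective p i j (perm _ _ (toℕ-injective (trans (!-old π p i) (trans (cong toℕ e) (sym (!-old π p j))))))

-- A pigeonhole argument: an injective map sends some index to a value at least as large as any
-- given index, here the last one.
max-position : ∀ {n} (π : Vec (Fin (suc n)) (suc n)) → IsPerm π → ∃ λ p → π ! p ≡ n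
max-position {n} π perm with p , _ , n≤ ← injective⇒existsPivot (λ {i} {j} → perm i j) (fromℕ n) =
  p , ℕ.≤-antisym (s≤s⁻¹ (!<n π p)) (subst (_≤ π ! p) (toℕ-fromℕ n) n≤)

!-ext : ∀ {n k} {π ρ : Vec (Fin n) k} → (∀ i → π ! i ≡ ρ ! i) → π ≡ ρ
!-ext e = lookup-ext λ i → toℕ-injective (e i)

IsPerm⇒insertMax : ∀ {n} (ρ : Vec (Fin (suc n)) (suc n)) → IsPerm ρ → ∃ λ π → ∃ λ p → ρ ≡ insertMax π p
IsPerm⇒insertMax {n} ρ perm with p , max ← max-position ρ perm = π , p , !-ext same
  where
  not-max : ∀ i → n ≢ ρ ! punchIn p i
  not-max i e = punchInᵢ≢i p i (perm _ _ (toℕ-injective (trans (sym e) (sym max))))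
  π : Vec (Fin n) n
  π = tabulateᵛ λ i → lower₁ (lookup ρ (punchIn p i)) (not-max i)
  same : ∀ j → ρ ! j ≡ insertMax π p ! j
  same j with place p j
  ... | new   = trans max (sym (!-new π p))
  ... | old i = sym (trans (!-old π p i) (trans (cong toℕ (lookup∘tabulate _ i)) (toℕ-lower₁ _ (not-max i))))

insertMax-injective : ∀ {n} {π ρ : Vec (Fin n) n} {p q} → insertMax π p ≡ insertMax ρ q → π ≡ ρ × p ≡ q
insertMax-injective {n} {π} {ρ} {p} {q} e with place p q
... | new   = !-ext (λ i → trans (sym (!-old π p i)) (trans (cong (_! punchIn p i) e) (!-old ρ p i))) , refl
... | old i = ⊥-elim (<-irrefl (trans (cong (_! punchIn p i) e) (trans (!-new ρ (punchIn p i)) (sym (!-new π p)))) (old<max π p i))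

Occurs : ∀ {n k} → Vec (Fin n) n → Vec (Fin k) k → (Fin k → Fin n) → Set
Occurs π τ ι =
  (∀ a b → toℕ a < toℕ b → toℕ (ι a) < toℕ (ι b)) ×
  (∀ a b → (π ! ι a < π ! ι b → τ ! a < τ ! b) × (τ ! a < τ ! b → π ! ι a < π ! ι b))

-- An occurrence of σ in π that becomes an occurrence of insertMax σ q once a maximum is inserted into π at p.
ContainsAt : ∀ {n k} → Vec (Fin n) n → Fin (suc n) → Vec (Fin k) k → Fin (suc k) → Set
ContainsAt π p σ q = ∃ λ ι → Occurs π σ ι × (∀ a → toℕ (ι a) < toℕ p ⇔ toℕ a < toℕ q)

module _ {n} {π : Vec (Fin n) n} {p : Fin (suc n)} where

  contains-old⁺ : ∀ {k} {τ : Vec (Fin k) k} → Contains π τ → Contains (insertMax π p) τ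
  contains-old⁺ (ι , mono , iso) = punchIn p ∘ ι , (λ a b → punchIn-mono-< p ∘ mono a b) , λ a b →
    proj₁ (iso a b) ∘ subst₂ _<_ (!-old π p (ι a)) (!-old π p (ι b)) ,
    subst₂ _<_ (sym (!-old π p (ι a))) (sym (!-old π p (ι b))) ∘ proj₂ (iso a b)

  -- The final component ties the pulled-back embedding to the original one; `contains-new⁻` uses it
  -- to see which entries lie to the left of `p`.
  contains-old⁻ : ∀ {k} {τ : Vec (Fin k) k} {ι} → Occurs (insertMax π p) τ ι → (∀ a → p ≢ ι a) →
                  ∃ λ κ → Occurs π τ κ × (∀ a → punchIn p (κ a) ≡ ι a)
  contains-old⁻ {k} {τ} {ι} (mono , iso) avoid =
    κ , ((λ a b a<b → punchIn-cancel-< p (subst₂ _<_ (cong toℕ (sym (e a))) (cong toℕ (sym (e b))) (mono a b a<b))) ,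
         (λ a b → proj₁ (iso a b) ∘ subst₂ _<_ (sym (v a)) (sym (v b)) , subst₂ _<_ (v a) (v b) ∘ proj₂ (iso a b))) , e
    where
    κ : Fin k → Fin n
    κ a = punchOut (avoid a)
    e : ∀ a → punchIn p (κ a) ≡ ι a
    e a = punchIn-punchOut (avoid a)
    v : ∀ a → insertMax π p ! ι a ≡ π ! κ a
    v a = trans (cong (insertMax π p !_) (sym (e a))) (!-old π p (κ a))

  module _ {k} {σ : Vec (Fin k) k} {q : Fin (suc k)} where

    contains-new⁺ : ContainsAt π p σ q → Contains (insertMax π p) (insertMax σ q)
    contains-new⁺ (ι , (mono , iso) , gap) =
      (λ a → ext (place q a)) , (λ a b → mono′ (place q a) (place q b)) , λ a b → iso′ (place q a) (place q b)
      where
      ext : ∀ {a} → Place q a → Fin (suc n)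
      ext new     = p
      ext (old a) = punchIn p (ι a)

      mono′ : ∀ {a b} (x : Place q a) (y : Place q b) → toℕ a < toℕ b → toℕ (ext x) < toℕ (ext y)
      mono′ new     new     lt = ⊥-elim (<-irrefl refl lt)
      mono′ new     (old b) lt = new<old⁺ p (≮⇒≥ λ ιb<p → <⇒≱ (to (gap b) ιb<p) (new<old⁻ q lt))
      mono′ (old a) new     lt = old<new⁺ p (from (gap a) (old<new⁻ q lt))
      mono′ (old a) (old b) lt = punchIn-mono-< p (mono a b (punchIn-cancel-< q lt))

      iso′ : ∀ {a b} (x : Place q a) (y : Place q b) →
             (insertMax π p ! ext x < insertMax π p ! ext y → insertMax σ q ! a < insertMax σ q ! b) ×
             (insertMax σ q ! a < insertMax σ q ! b → insertMax π p ! ext x < insertMax π p ! ext y)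
      iso′ new     new     = ⊥-elim ∘ <-irrefl refl , ⊥-elim ∘ <-irrefl refl
      iso′ new     (old b) = ⊥-elim ∘ <-asym (old<max π p (ι b)) , ⊥-elim ∘ <-asym (old<max σ q b)
      iso′ (old a) new     = (λ _ → old<max σ q a) , (λ _ → old<max π p (ι a))
      iso′ (old a) (old b) =
        subst₂ _<_ (sym (!-old σ q a)) (sym (!-old σ q b)) ∘ proj₁ (iso a b) ∘ subst₂ _<_ (!-old π p (ι a)) (!-old π p (ι b)) ,
        subst₂ _<_ (sym (!-old π p (ι a))) (sym (!-old π p (ι b))) ∘ proj₂ (iso a b) ∘ subst₂ _<_ (!-old σ q a) (!-old σ q b)

    contains-new⁻ : Contains (insertMax π p) (insertMax σ q) → Contains π (insertMax σ q) ⊎ ContainsAt π p σ q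
    contains-new⁻ (ι , mono , iso) with any? (λ a → p Fin.≟ ι a)
    ... | no avoid = let κ , occ , _ = contains-old⁻ {τ = insertMax σ q} (mono , iso) (λ a e → avoid (a , e)) in inj₁ (κ , occ)
    ... | yes (a , p≡ιa) with place q a
    -- Here the inserted maximum plays a smaller entry of the pattern, so the entry playing the
    -- pattern's maximum would have to exceed it.
    ...   | old b = ⊥-elim (<⇒≱ (subst (λ x → insertMax π p ! x < insertMax π p ! ι q) (sym p≡ιa) (proj₂ (iso _ q) (old<max σ q b)))
                             (subst (insertMax π p ! ι q ≤_) (sym (!-new π p)) (s≤s⁻¹ (!<n (insertMax π p) (ι q)))))
    ...   | new =
      let κ , occ , e = contains-old⁻ {τ = σ} {ι = ι ∘ punchIn q} old-occurs avoid in
      inj₂ (κ , occ , λ b → mk⇔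
        (λ κb<p → ≰⇒> λ q≤b → <-asym (subst (_< toℕ p) (cong toℕ (e b)) (old<new⁺ p κb<p))
                     (subst (λ x → toℕ x < toℕ (ι (punchIn q b))) (sym p≡ιa) (mono q (punchIn q b) (new<old⁺ q q≤b))))
        (λ b<q → old<new⁻ p (subst₂ (λ x y → toℕ x < toℕ y) (sym (e b)) (sym p≡ιa) (mono (punchIn q b) q (old<new⁺ q b<q)))))
      where
      old-occurs : Occurs (insertMax π p) σ (ι ∘ punchIn q)
      old-occurs = (λ a b a<b → mono _ _ (punchIn-mono-< q a<b)) , λ a b →
        subst₂ _<_ (!-old σ q a) (!-old σ q b) ∘ proj₁ (iso _ _) ,
        proj₂ (iso _ _) ∘ subst₂ _<_ (sym (!-old σ q a)) (sym (!-old σ q b))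
      distinct : ∀ b → ι q ≢ ι (punchIn q b)
      distinct b e with ℕ.<-cmp (toℕ q) (toℕ (punchIn q b))
      ... | tri< lt _ _ = <-irrefl (cong toℕ e) (mono _ _ lt)
      ... | tri≈ _ eq _ = punchInᵢ≢i q b (sym (toℕ-injective eq))
      ... | tri> _ _ gt = <-irrefl (cong toℕ (sym e)) (mono _ _ gt)
      avoid : ∀ b → p ≢ ι (punchIn q b)
      avoid b e = distinct b (trans (sym p≡ιa) e)

-- Patterns split at their 4, and the shapes of triples

PatternAt : Set
PatternAt = Fin 4 × Vec (Fin 3) 3

-- On literals `insertMax σ q` computes to the four digits, so the bases obtained this way agree by
-- definition with the lists in the theorem.
patterns : List PatternAt → List (Vec (Fin 4) 4)
patterns = map λ (q , σ) → insertMax σ q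

AvoidsAllAt : ∀ {n} → Vec (Fin n) n → Fin (suc n) → List PatternAt → Set
AvoidsAllAt π p []            = ⊤
AvoidsAllAt π p ((q , σ) ∷ G) = ¬ ContainsAt π p σ q × AvoidsAllAt π p G

avoidsAll-insertMax⁺ : ∀ {n} {π : Vec (Fin n) n} {p} G → AvoidsAll π (patterns G) → AvoidsAllAt π p G →
                       AvoidsAll (insertMax π p) (patterns G)
avoidsAll-insertMax⁺ []      _        _        = tt
avoidsAll-insertMax⁺ (_ ∷ G) (a , as) (b , bs) =
  (λ c → [ a , b ] (contains-new⁻ c)) , avoidsAll-insertMax⁺ G as bs

avoidsAll-insertMax⁻ : ∀ {n} {π : Vec (Fin n) n} {p} G → AvoidsAll (insertMax π p) (patterns G) →
                       AvoidsAll π (patterns G) × AvoidsAllAt π p G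
avoidsAll-insertMax⁻ []      _        = tt , tt
avoidsAll-insertMax⁻ {π = π} {p} ((q , σ) ∷ G) (a , as) =
  let bs , cs = avoidsAll-insertMax⁻ G as in (a ∘ contains-old⁺ {π = π} {p} {τ = insertMax σ q} , bs) , (a ∘ contains-new⁺ {π = π} {p} {σ = σ} {q} , cs)

triple : ∀ {A : Set} → A → A → A → Fin 3 → A
triple x y z 0F = x
triple x y z 1F = y
triple x y z 2F = z

increasing : ∀ {f : Fin 3 → ℕ} → f 0F < f 1F → f 1F < f 2F → ∀ {a b} → toℕ a < toℕ b → f a < f b
increasing p q {0F} {1F} _ = p
increasing p q {0F} {2F} _ = <-trans p q
increasing p q {1F} {2F} _ = q
increasing p q {1F} {1F} (s≤s ())
increasing p q {2F} {1F} (s≤s ())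
increasing p q {2F} {2F} (s≤s (s≤s ()))

increasing⁻ : ∀ {f : Fin 3 → ℕ} → f 0F < f 1F → f 1F < f 2F → ∀ {a b} → f a < f b → toℕ a < toℕ b
increasing⁻ {f} p q {a} {b} fa<fb with ℕ.<-cmp (toℕ a) (toℕ b)
... | tri< lt _ _ = lt
... | tri≈ _ eq _ = ⊥-elim (<-irrefl (cong f (toℕ-injective eq)) fa<fb)
... | tri> _ _ gt = ⊥-elim (<-asym fa<fb (increasing {f} p q gt))

pattern ⟨123⟩ = 0F ∷ 1F ∷ 2F ∷ []
pattern ⟨132⟩ = 0F ∷ 2F ∷ 1F ∷ []
pattern ⟨213⟩ = 1F ∷ 0F ∷ 2F ∷ []
pattern ⟨231⟩ = 1F ∷ 2F ∷ 0F ∷ []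
pattern ⟨312⟩ = 2F ∷ 0F ∷ 1F ∷ []
pattern ⟨321⟩ = 2F ∷ 1F ∷ 0F ∷ []

data Shape (u v w : ℕ) : Vec (Fin 3) 3 → Set where
  s123 : u < v → v < w → Shape u v w ⟨123⟩
  s132 : u < w → w < v → Shape u v w ⟨132⟩
  s213 : v < u → u < w → Shape u v w ⟨213⟩
  s231 : w < u → u < v → Shape u v w ⟨231⟩
  s312 : v < w → w < u → Shape u v w ⟨312⟩
  s321 : w < v → v < u → Shape u v w ⟨321⟩

module _ {n} {π : Vec (Fin n) n} where

  compare : IsPerm π → ∀ i j → i ≢ j → π ! i < π ! j ⊎ π ! j < π ! i
  compare perm i j i≢j with ℕ.<-cmp (π ! i) (π ! j)
  ... | tri< lt _ _ = inj₁ lt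
  ... | tri≈ _ eq _ = ⊥-elim (i≢j (perm i j (toℕ-injective eq)))
  ... | tri> _ _ gt = inj₂ gt

  compare-< : IsPerm π → ∀ {i j} → toℕ i < toℕ j → π ! i < π ! j ⊎ π ! j < π ! i
  compare-< perm i<j = compare perm _ _ λ e → <-irrefl (cong toℕ e) i<j

  classify : IsPerm π → ∀ {i j k} → toℕ i < toℕ j → toℕ j < toℕ k → ∃ (Shape (π ! i) (π ! j) (π ! k))
  classify perm i<j j<k with compare-< perm i<j | compare-< perm j<k | compare-< perm (<-trans i<j j<k)
  ... | inj₁ p | inj₁ q | _      = _ , s123 p q
  ... | inj₁ p | inj₂ q | inj₁ r = _ , s132 r q
  ... | inj₁ p | inj₂ q | inj₂ r = _ , s231 r p
  ... | inj₂ p | inj₁ q | inj₁ r = _ , s213 p r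
  ... | inj₂ p | inj₁ q | inj₂ r = _ , s312 q r
  ... | inj₂ p | inj₂ q | _      = _ , s321 q p

  shape-occurs : ∀ {i j k} {σ : Vec (Fin 3) 3} → toℕ i < toℕ j → toℕ j < toℕ k → Shape (π ! i) (π ! j) (π ! k) σ → Occurs π σ (triple i j k)
  shape-occurs {i} {j} {k} {σ} i<j j<k shape =
    (λ a b → increasing {toℕ ∘ triple i j k} i<j j<k {a} {b}) , λ a b → ordered shape a b
    where
    -- f lists the values in increasing order, so that σ gives the rank of each entry.
    ranks : (f : Fin 3 → ℕ) → f 0F < f 1F → f 1F < f 2F → (∀ a → π ! triple i j k a ≡ f (lookup σ a)) →
            ∀ a b → (π ! triple i j k a < π ! triple i j k b → σ ! a < σ ! b) × (σ ! a < σ ! b → π ! triple i j k a < π ! triple i j k b)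
    ranks f p q e a b =
      (λ lt → increasing⁻ {f} p q (subst₂ _<_ (e a) (e b) lt)) ,
      (λ lt → subst₂ _<_ (sym (e a)) (sym (e b)) (increasing {f} p q lt))

    ordered : Shape (π ! i) (π ! j) (π ! k) σ →
              ∀ a b → (π ! triple i j k a < π ! triple i j k b → σ ! a < σ ! b) × (σ ! a < σ ! b → π ! triple i j k a < π ! triple i j k b)
    ordered (s123 p q) = ranks (triple (π ! i) (π ! j) (π ! k)) p q λ { 0F → refl ; 1F → refl ; 2F → refl }
    ordered (s132 p q) = ranks (triple (π ! i) (π ! k) (π ! j)) p q λ { 0F → refl ; 1F → refl ; 2F → refl }
    ordered (s213 p q) = ranks (triple (π ! j) (π ! i) (π ! k)) p q λ { 0F → refl ; 1F → refl ; 2F → refl }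
    ordered (s231 p q) = ranks (triple (π ! k) (π ! i) (π ! j)) p q λ { 0F → refl ; 1F → refl ; 2F → refl }
    ordered (s312 p q) = ranks (triple (π ! j) (π ! k) (π ! i)) p q λ { 0F → refl ; 1F → refl ; 2F → refl }
    ordered (s321 p q) = ranks (triple (π ! k) (π ! j) (π ! i)) p q λ { 0F → refl ; 1F → refl ; 2F → refl }

  module _ {p : Fin (suc n)} where

    private
      both : ∀ {X Y : Set} → X → Y → X ⇔ Y
      both x y = mk⇔ (λ _ → y) (λ _ → x)
      neither : ∀ {a b c d} → b ≤ a → d ≤ c → a < b ⇔ c < d
      neither x y = mk⇔ (λ lt → ⊥-elim (<⇒≱ lt x)) (λ lt → ⊥-elim (<⇒≱ lt y))

    -- The number in the name counts the entries to the left of `p`, which is the index of the 4 in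
    -- the pattern produced.
    at1 : ∀ {i j k σ} → toℕ i < toℕ p → toℕ p ≤ toℕ j → toℕ j < toℕ k → Shape (π ! i) (π ! j) (π ! k) σ → ContainsAt π p σ 1F
    at1 {i} {j} {k} {σ} i<p p≤j j<k shape = triple i j k , shape-occurs {σ = σ} (<-≤-trans i<p p≤j) j<k shape , λ
      { 0F → both i<p (s≤s z≤n)
      ; 1F → neither p≤j (s≤s z≤n)
      ; 2F → neither (≤-trans p≤j (<⇒≤ j<k)) (s≤s z≤n)
      }

    at2 : ∀ {i j k σ} → toℕ i < toℕ j → toℕ j < toℕ p → toℕ p ≤ toℕ k → Shape (π ! i) (π ! j) (π ! k) σ → ContainsAt π p σ 2F
    at2 {i} {j} {k} {σ} i<j j<p p≤k shape = triple i j k , shape-occurs {σ = σ} i<j (<-≤-trans j<p p≤k) shape , λ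
      { 0F → both (<-trans i<j j<p) (s≤s z≤n)
      ; 1F → both j<p (s≤s (s≤s z≤n))
      ; 2F → neither p≤k (s≤s (s≤s z≤n))
      }

    at3 : ∀ {i j k σ} → toℕ i < toℕ j → toℕ j < toℕ k → toℕ k < toℕ p → Shape (π ! i) (π ! j) (π ! k) σ → ContainsAt π p σ 3F
    at3 {i} {j} {k} {σ} i<j j<k k<p shape = triple i j k , shape-occurs {σ = σ} i<j j<k shape , λ
      { 0F → both (<-trans i<j (<-trans j<k k<p)) (s≤s z≤n)
      ; 1F → both (<-trans j<k k<p) (s≤s (s≤s z≤n))
      ; 2F → both k<p (s≤s (s≤s (s≤s z≤n)))
      }

-- Special positions and monotone prefixes

Max : ∀ {n} → Vec (Fin n) n → ℕ → Set
Max {n} π c = ∃ λ i → toℕ i ≡ c × suc (π ! i) ≡ n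

max≮ : ∀ {n} {π : Vec (Fin n) n} {i j} → suc (π ! i) ≡ n → ¬ π ! i < π ! j
max≮ {π = π} {i} {j} max lt = <⇒≱ (!<n π j) (subst (_≤ π ! j) max lt)

greatest⇒max : ∀ {n} {π : Vec (Fin n) n} {i} → IsPerm π → (∀ k → k ≢ i → π ! k < π ! i) → suc (π ! i) ≡ n
greatest⇒max {suc n} {π} {i} perm greatest with t , max ← max-position π perm with t Fin.≟ i
... | yes refl = cong suc max
... | no t≢i   = ⊥-elim (<⇒≱ (!<n π i) (subst (λ m → suc m ≤ π ! i) max (greatest t t≢i)))

max-insertMax⁺ : ∀ {n} (π : Vec (Fin n) n) p → Max (insertMax π p) (toℕ p)
max-insertMax⁺ π p = p , refl , cong suc (!-new π p)

max-insertMax⁻ : ∀ {n} {π : Vec (Fin n) n} {p c} → Max (insertMax π p) c → toℕ p ≡ c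
max-insertMax⁻ {π = π} {p} (i , e , max) with place p i
... | new   = e
... | old j = ⊥-elim (<-irrefl (ℕ.suc-injective (trans (cong suc (sym (!-old π p j))) max)) (!<n π j))

-- The condition `2 ≤ n` keeps special and normal positions apart: in `DirectSum`, position 1 of the
-- one-entry permutation is its end, hence a cut, although the lone entry is a maximum at position
-- 0.
SpecialAt : ℕ → ℕ → ∀ {n} → Vec (Fin n) n → Fin (suc n) → Set
SpecialAt c a {n} π p = toℕ p ≡ c × 2 ≤ n × Max π a

specialAt-unique : ∀ {c a n} {π : Vec (Fin n) n} {p q} → SpecialAt c a π p → SpecialAt c a π q → p ≡ q
specialAt-unique (e , _) (f , _) = toℕ-injective (trans e (sym f))

specialAt-insertMax : ∀ {c a n} {π : Vec (Fin n) n} {p} → c ≤ suc n → 1 ≤ n → toℕ p ≡ a → ∃ (SpecialAt c a (insertMax π p))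
specialAt-insertMax {π = π} {p} c≤ 1≤n refl = fromℕ< (s≤s c≤) , toℕ-fromℕ< (s≤s c≤) , s≤s 1≤n , max-insertMax⁺ π p

¬specialAt-insertMax : ∀ {c a n} {π : Vec (Fin n) n} {p} → toℕ p ≢ a → ∀ q → ¬ SpecialAt c a (insertMax π p) q
¬specialAt-insertMax {π = π} {p} p≢a q (_ , _ , max) = p≢a (max-insertMax⁻ {π = π} {p} max)

¬specialAt-one : ∀ {c a} p → ¬ SpecialAt c a (0F ∷ []) p
¬specialAt-one p (_ , s≤s () , _)

Prefix : (ℕ → ℕ → Set) → ∀ {n} → Vec (Fin n) n → ℕ → Set
Prefix _~_ π c = ∀ i j → toℕ i < toℕ j → toℕ j < c → π ! i ~ π ! j

module _ {_~_ : ℕ → ℕ → Set} {n} {π : Vec (Fin n) n} where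

  prefix-mono : ∀ {c d} → d ≤ c → Prefix _~_ π c → Prefix _~_ π d
  prefix-mono d≤c pre i j i<j j<d = pre i j i<j (<-≤-trans j<d d≤c)

  prefix-≤1 : ∀ {c} → c ≤ 1 → Prefix _~_ π c
  prefix-≤1 c≤1 i j i<j j<c = ⊥-elim (<⇒≱ (<-≤-trans j<c c≤1) (≤-trans (s≤s z≤n) i<j))

  prefix-2 : ∀ {x y} → toℕ x ≡ 0 → toℕ y ≡ 1 → π ! x ~ π ! y → Prefix _~_ π 2
  prefix-2 {x} {y} x≡0 y≡1 r i j i<j j<2 = subst₂ (λ a b → π ! a ~ π ! b) (toℕ-injective (trans x≡0 (sym i≡0))) (toℕ-injective (trans y≡1 (sym j≡1))) r
    where
    i≡0 = ≤-antisym (s≤s⁻¹ (≤-trans i<j (s≤s⁻¹ j<2))) z≤n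
    j≡1 = ≤-antisym (s≤s⁻¹ j<2) (≤-trans (s≤s z≤n) i<j)

  -- Pattern avoidance speaks of triples, a prefix of pairs. With three indices below c every pair
  -- completes to a triple by 0, 1 or 2, according to where the pair leaves room. For c = 2 there is
  -- no such completion, which is why position 2 is exceptional.
  prefix-≥3 : ∀ {c} → 3 ≤ c → c ≤ n →
              (∀ i j k → toℕ i < toℕ j → toℕ j < toℕ k → toℕ k < c → π ! i ~ π ! j × π ! j ~ π ! k × π ! i ~ π ! k) →
              Prefix _~_ π c
  prefix-≥3 {c} 3≤c c≤n triples i j i<j j<c with 0 <? toℕ i
  ... | yes 0<i = proj₁ (proj₂ (triples x i j (subst (_< toℕ i) (sym x≡0) 0<i) i<j j<c))
    where
    x = fromℕ< (≤-trans (s≤s z≤n) (≤-trans 3≤c c≤n))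
    x≡0 : toℕ x ≡ 0
    x≡0 = toℕ-fromℕ< (≤-trans (s≤s z≤n) (≤-trans 3≤c c≤n))
  ... | no i≯0 with 1 <? toℕ j
  ...   | yes 1<j = proj₂ (proj₂ (triples i x j (subst (toℕ i <_) (sym x≡1) (s≤s (≮⇒≥ i≯0))) (subst (_< toℕ j) (sym x≡1) 1<j) j<c))
    where
    x = fromℕ< (≤-trans (s≤s (s≤s z≤n)) (≤-trans 3≤c c≤n))
    x≡1 : toℕ x ≡ 1
    x≡1 = toℕ-fromℕ< (≤-trans (s≤s (s≤s z≤n)) (≤-trans 3≤c c≤n))
  ...   | no j≯1 = proj₁ (triples i j x i<j (subst (toℕ j <_) (sym x≡2) (s≤s (≮⇒≥ j≯1))) (subst (_< c) (sym x≡2) 3≤c))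
    where
    x = fromℕ< (≤-trans 3≤c c≤n)
    x≡2 : toℕ x ≡ 2
    x≡2 = toℕ-fromℕ< (≤-trans 3≤c c≤n)

  module _ {p : Fin (suc n)} where

    prefix-insertMax⁺ : ∀ {c} → c ≤ toℕ p → Prefix _~_ π c → Prefix _~_ (insertMax π p) c
    prefix-insertMax⁺ c≤p pre i j i<j j<c with place p i | place p j
    ... | _     | new   = ⊥-elim (<⇒≱ j<c c≤p)
    ... | new   | old j = ⊥-elim (<⇒≱ (<-trans i<j j<c) c≤p)
    ... | old i | old j = subst₂ _~_ (sym (!-old π p i)) (sym (!-old π p j))
                            (pre i j (punchIn-cancel-< p i<j) (≤-<-trans (punchIn-increasing p j) j<c))

    prefix-insertMax⁻ : ∀ {c} → c ≤ toℕ p → Prefix _~_ (insertMax π p) c → Prefix _~_ π c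
    prefix-insertMax⁻ c≤p pre i j i<j j<c = subst₂ _~_ (!-old π p i) (!-old π p j)
      (pre (punchIn p i) (punchIn p j) (punchIn-mono-< p i<j) (subst (_< _) (sym (punchIn-below p (<-≤-trans j<c c≤p))) j<c))

record LongestPrefix (_~_ : ℕ → ℕ → Set) {n} (π : Vec (Fin n) n) (m : ℕ) : Set where
  field
    nonempty : 1 ≤ m
    bounded  : m ≤ n
    holds    : Prefix _~_ π m
    longest  : ∀ {c} → c ≤ n → Prefix _~_ π c → c ≤ m

  1≤n : 1 ≤ n
  1≤n = ≤-trans nonempty bounded

-- Insertion at position 2 leaves the first two entries in place, so they still break the prefix
-- after its first entry.
longestPrefix-special : ∀ {_~_ n} {π : Vec (Fin n) n} {p} → toℕ p ≡ 2 → ¬ Prefix _~_ π 2 → LongestPrefix _~_ (insertMax π p) 1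
longestPrefix-special {_~_} {π = π} {p} p≡2 ¬pre = record
  { nonempty = ≤-refl
  ; bounded  = s≤s z≤n
  ; holds    = prefix-≤1 {_~_} {π = insertMax π p} ≤-refl
  ; longest  = λ _ pre → ≮⇒≥ λ 1<c → ¬pre (prefix-insertMax⁻ {_~_} {π = π} {p} (≤-reflexive (sym p≡2)) (prefix-mono {_~_} {π = insertMax π p} 1<c pre))
  }

longestPrefix-one : ∀ {_~_} → LongestPrefix _~_ (0F ∷ []) 1
longestPrefix-one {_~_} = record
  { nonempty = ≤-refl ; bounded = ≤-refl ; holds = prefix-≤1 {_~_} {π = 0F ∷ []} ≤-refl ; longest = λ c≤1 _ → c≤1 }

below-two : ∀ {n} {x y : Fin n} {c} → toℕ x < toℕ y → toℕ y < c → c ≡ 2 → toℕ x ≡ 0 × toℕ y ≡ 1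
below-two x<y y<2 refl = ≤-antisym (s≤s⁻¹ (≤-trans x<y (s≤s⁻¹ y<2))) z≤n , ≤-antisym (s≤s⁻¹ y<2) (≤-trans (s≤s z≤n) x<y)

-- Three entries do not fit in front of position 2, so patterns ending in 4 say nothing about an
-- insertion there.
¬containsAt-2 : ∀ {n} {π : Vec (Fin n) n} {p} (σ : Vec (Fin 3) 3) → toℕ p ≡ 2 → ¬ ContainsAt π p σ 3F
¬containsAt-2 σ p≡2 (ι , (mono , _) , gap) =
  <⇒≱ (subst (toℕ (ι 2F) <_) p≡2 (from (gap 2F) ≤-refl))
      (≤-trans (s≤s (≤-trans (s≤s z≤n) (mono 0F 1F (s≤s z≤n)))) (mono 1F 2F (s≤s (s≤s z≤n))))

prefix-or-special : ∀ {_~_ a n} {π : Vec (Fin n) n} {p} → toℕ p ≡ 2 →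
                    (∀ {x y} → toℕ x ≡ 0 → toℕ y ≡ 1 → (π ! x) ~ (π ! y) ⊎ Max π a) → Prefix _~_ π (toℕ p) ⊎ SpecialAt 2 a π p
prefix-or-special {_~_} {a} {n} {π} {p} p≡2 split with split (toℕ-fromℕ< (≤-trans (s≤s z≤n) 2≤n)) (toℕ-fromℕ< 2≤n)
  where
  2≤n : 2 ≤ n
  2≤n = subst (_≤ n) p≡2 (s≤s⁻¹ (toℕ<n p))
... | inj₁ r   = inj₁ (subst (Prefix _~_ π) (sym p≡2) (prefix-2 {_~_} {π = π} (toℕ-fromℕ< _) (toℕ-fromℕ< _) r))
... | inj₂ max = inj₂ (p≡2 , subst (_≤ n) p≡2 (s≤s⁻¹ (toℕ<n p)) , max)

zero-or-one : ∀ {n} {x y : Fin n} → toℕ x ≡ 0 → toℕ y ≡ 1 → ∀ k → k ≡ x ⊎ k ≡ y ⊎ 2 ≤ toℕ k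
zero-or-one x≡0 y≡1 k with toℕ k in e
... | 0           = inj₁ (toℕ-injective (trans e (sym x≡0)))
... | 1           = inj₂ (inj₁ (toℕ-injective (trans e (sym y≡1))))
... | suc (suc _) = inj₂ (inj₂ (s≤s (s≤s z≤n)))

-- The two succession rules and their equal counts

data Label : Set where
  normal : ℕ → Label
  star   : Label

arity : Label → ℕ
arity (normal m) = suc m
arity star       = 3

normalChild : ∀ {m} → Fin (suc m) → Label
normalChild zero    = star
normalChild (suc k) = normal (suc (suc (toℕ k)))

childLabel : ∀ l → Fin (arity l) → Label
childLabel (normal m) k       = normalChild k
childLabel star       zero    = normal 1
childLabel star       (suc k) = normalChild k

permKids : Label → List Label
permKids l = tabulate (childLabel l)

permDescendants : ℕ → Label → ℕ
permDescendants = descendants permKids λ _ → true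

simDescendants : ℕ → ℕ → ℕ
simDescendants = descendants simKids nonzero

sum-tabulate-applyUpTo : ∀ {L M : Set} (f : L → ℕ) (g : M → ℕ) m {h : Fin m → L} {i : ℕ → M} → (∀ k → f (h k) ≡ g (i (toℕ k))) →
                         sum (map f (tabulate h)) ≡ sum (map g (applyUpTo i m))
sum-tabulate-applyUpTo f g zero    e = refl
sum-tabulate-applyUpTo f g (suc m) e = cong₂ _+_ (e zero) (sum-tabulate-applyUpTo f g m (e ∘ suc))

-- In simKids a vertex linked to nothing must next be linked to exactly one vertex,
-- so the two children 0 and 1 together account for the single child star.
mutual
  perm≡sim : ∀ k d → permDescendants k (normal (suc d)) ≡ simDescendants k (suc d)
  perm≡sim zero    d = refl
  perm≡sim (suc k) d = trans
    (cong₂ _+_ (star≡sim k) (sum-tabulate-applyUpTo (permDescendants k) (simDescendants k) (suc d) {i = λ j → suc (suc j)} λ j → perm≡sim k (suc (toℕ j))))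
    -- Splits the share of `star` into those of 0 and 1, the first two children of `suc d`.
    (ℕ.+-assoc (simDescendants k 0) (simDescendants k 1) _)

  star≡sim : ∀ k → permDescendants k star ≡ simDescendants k 0 + simDescendants k 1
  star≡sim zero    = refl
  -- The children of `star` are `normal 1` followed by the children of `normal 1`, so everything
  -- after the first summand is, by definition, the next generation below `normal 1`. On the other
  -- side 0 has the single child 1.
  star≡sim (suc k) =
    cong₂ _+_ (trans (perm≡sim k 0) (sym (ℕ.+-identityʳ _))) (perm≡sim (suc k) 0)

-- The tree shared by the three classes of permutations

avoidsAll-one : ∀ (π : Vec (Fin 1) 1) E → AvoidsAll π E
avoidsAll-one π []      = tt
avoidsAll-one π (_ ∷ E) =
  (λ (ι , mono , _) → <⇒≱ (≤-<-trans z≤n (mono 0F 1F (s≤s z≤n))) (s≤s⁻¹ (toℕ<n (ι 1F)))) , avoidsAll-one π E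

-- What the succession rule needs to know about a class. `Sites π m` certifies that the normal
-- positions are exactly `site s 0` to `site s m`, numbered so that insertion at number k leaves k +
-- 2 of them and that number 0 is where a maximum makes a special position available.
record Family : Set₁ where
  field
    forbidden : List PatternAt

    Normal : ∀ {n} → Vec (Fin n) n → ℕ → Set
    specialPosition maxPosition : ℕ

  Special : ∀ {n} → Vec (Fin n) n → Fin (suc n) → Set
  Special = SpecialAt specialPosition maxPosition

  field
    avoidsAt⁺ : ∀ {n} (π : Vec (Fin n) n) p → Normal π (toℕ p) ⊎ Special π p → AvoidsAllAt π p forbidden
    avoidsAt⁻ : ∀ {n} (π : Vec (Fin n) n) p → IsPerm π → AvoidsAllAt π p forbidden → Normal π (toℕ p) ⊎ Special π p

    specialPosition≤2 : specialPosition ≤ 2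
    special≢max       : specialPosition ≢ maxPosition
    special⇒¬normal   : ∀ {n} {π : Vec (Fin n) n} {p} → Special π p → ¬ Normal π (toℕ p)

    Sites          : ∀ {n} → Vec (Fin n) n → ℕ → Set
    sites-nonempty : ∀ {n m} {π : Vec (Fin n) n} → Sites π m → 1 ≤ n
    site           : ∀ {n m} {π : Vec (Fin n) n} → Sites π m → ℕ → ℕ
    site-bounded   : ∀ {n m} {π : Vec (Fin n) n} (s : Sites π m) {k} → k ≤ m → site s k ≤ n
    site-injective : ∀ {n m} {π : Vec (Fin n) n} (s : Sites π m) {j k} → j ≤ m → k ≤ m → site s j ≡ site s k → j ≡ k
    site-normal    : ∀ {n m} {π : Vec (Fin n) n} (s : Sites π m) {k} → k ≤ m → Normal π (site s k)
    normal-site    : ∀ {n m} {π : Vec (Fin n) n} (s : Sites π m) {c} → c ≤ n → Normal π c → ∃ λ k → k ≤ m × c ≡ site s k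
    site-first     : ∀ {n m} {π : Vec (Fin n) n} (s : Sites π m) → site s 0 ≡ maxPosition

    sites-normal  : ∀ {n m} {π : Vec (Fin n) n} (s : Sites π m) {k p} → k ≤ m → toℕ p ≡ site s k → Sites (insertMax π p) (suc k)
    sites-special : ∀ {n} {π : Vec (Fin n) n} {p} → Special π p → Sites (insertMax π p) 1
    sites-one     : Sites (0F ∷ []) 1

  HasLabel : ∀ {n} → Vec (Fin n) n → Label → Set
  HasLabel π (normal m) = Sites π m × (∀ p → ¬ Special π p)
  HasLabel π star       = Sites π 1 × ∃ (Special π)

  basis : List (Vec (Fin 4) 4)
  basis = patterns forbidden

  record Growth {n} (π : Vec (Fin n) n) (l : Label) : Set where
    field
      position  : Fin (arity l) → Fin (suc n)
      injective : ∀ {j k} → position j ≡ position k → j ≡ k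
      allowed   : ∀ k → Normal π (toℕ (position k)) ⊎ Special π (position k)
      complete  : ∀ {p} → Normal π (toℕ p) ⊎ Special π p → ∃ λ k → p ≡ position k
      labelled  : ∀ k → HasLabel (insertMax π (position k)) (childLabel l k)

  module _ {n m} {π : Vec (Fin n) n} (s : Sites π m) where

    slot : Fin (suc m) → Fin (suc n)
    slot k = fromℕ< (s≤s (site-bounded s (s≤s⁻¹ (toℕ<n k))))

    toℕ-slot : ∀ k → toℕ (slot k) ≡ site s (toℕ k)
    toℕ-slot k = toℕ-fromℕ< _

    slot-injective : ∀ {j k} → slot j ≡ slot k → j ≡ k
    slot-injective {j} {k} e = toℕ-injective (site-injective s (s≤s⁻¹ (toℕ<n j)) (s≤s⁻¹ (toℕ<n k))
      (trans (sym (toℕ-slot j)) (trans (cong toℕ e) (toℕ-slot k))))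

    slot-normal : ∀ k → Normal π (toℕ (slot k))
    slot-normal k = subst (Normal π) (sym (toℕ-slot k)) (site-normal s (s≤s⁻¹ (toℕ<n k)))

    normal-slot : ∀ {p} → Normal π (toℕ p) → ∃ λ k → p ≡ slot k
    normal-slot {p} h with k , k≤m , e ← normal-site s (s≤s⁻¹ (toℕ<n p)) h =
      fromℕ< (s≤s k≤m) , toℕ-injective (trans e (sym (trans (toℕ-slot _) (cong (site s) (toℕ-fromℕ< (s≤s k≤m))))))

    child-labelled : ∀ k → HasLabel (insertMax π (slot k)) (normalChild k)
    child-labelled zero =
      sites-normal s z≤n (toℕ-slot zero) ,
      specialAt-insertMax {π = π} (≤-trans specialPosition≤2 (s≤s (sites-nonempty s))) (sites-nonempty s) (trans (toℕ-slot zero) (site-first s))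
    child-labelled (suc k) =
      sites-normal s (s≤s⁻¹ (toℕ<n (suc k))) (toℕ-slot (suc k)) ,
      ¬specialAt-insertMax {π = π} λ e → later (site-injective s (s≤s⁻¹ (toℕ<n (suc k))) z≤n
        (trans (sym (toℕ-slot (suc k))) (trans e (sym (site-first s)))))
      where
      later : suc (toℕ k) ≢ 0
      later ()

  growth : ∀ {n} (π : Vec (Fin n) n) l → HasLabel π l → Growth π l
  growth π (normal m) (s , ¬special) = record
    { position  = slot s
    ; injective = slot-injective s
    ; allowed   = λ k → inj₁ (slot-normal s k)
    ; complete  = [ normal-slot s , ⊥-elim ∘ ¬special _ ]
    ; labelled  = child-labelled s
    }
  growth π star (s , p , special) = record
    { position  = position
    ; injective = injective
    ; allowed   = λ { zero → inj₂ special ; (suc k) → inj₁ (slot-normal s k) }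
    ; complete  = [ (λ h → let k , e = normal-slot s h in suc k , e) , (λ q → zero , specialAt-unique {π = π} q special) ]
    ; labelled  = λ
      -- The new maximum now stands at `specialPosition`, which is not `maxPosition`, so no special
      -- position survives.
      { zero    → sites-special special , ¬specialAt-insertMax {π = π} λ e → special≢max (trans (sym (proj₁ special)) e)
      ; (suc k) → child-labelled s k
      }
    }
    where
    position : Fin 3 → Fin _
    position zero    = p
    position (suc k) = slot s k
    injective : ∀ {j k} → position j ≡ position k → j ≡ k
    injective {zero}  {zero}  e = refl
    injective {zero}  {suc k} e = ⊥-elim (special⇒¬normal special (subst (Normal π ∘ toℕ) (sym e) (slot-normal s k)))
    injective {suc j} {zero}  e = ⊥-elim (special⇒¬normal special (subst (Normal π ∘ toℕ) e (slot-normal s j)))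
    injective {suc j} {suc k} e = cong suc (slot-injective s e)

  tree : GeneratingTree {λ n → Vec (Fin n) n} (InAv basis) HasLabel permKids
  tree = record
    { _⊲_      = λ π ρ → ∃ λ p → ρ ≡ insertMax π p
    ; ⊲-unique = λ (p , e) (q , f) → proj₁ (insertMax-injective (trans (sym e) f))
    ; parent   = parent
    ; grow     = grow
    }
    where
    parent : ∀ {n} (ρ : Vec (Fin (suc n)) (suc n)) → InAv basis ρ → ∃ λ π → InAv basis π × ∃ λ p → ρ ≡ insertMax π p
    parent ρ (perm , avoids) with π , p , refl ← IsPerm⇒insertMax ρ perm =
      π , (IsPerm-insertMax⁻ {π = π} {p} perm , proj₁ (avoidsAll-insertMax⁻ {π = π} {p} forbidden avoids)) , p , refl

    grow : ∀ {n} (π : Vec (Fin n) n) {l} → InAv basis π → HasLabel π l →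
           Enumeration HasLabel (λ ρ → (∃ λ p → ρ ≡ insertMax π p) × InAv basis ρ) (permKids l)
    grow π {l} (perm , avoids) label = subst (Enumeration HasLabel _) (map-tabulate id (childLabel l))
      (choices (λ k → insertMax π (position k)) (childLabel l) (allFin (arity l)) (Unique.allFin⁺ _)
        (λ _ _ e → injective (proj₂ (insertMax-injective e)))
        (λ {k} _ → ((position k , refl) , IsPerm-insertMax⁺ {π = π} {position k} perm ,
                      avoidsAll-insertMax⁺ {π = π} {position k} forbidden avoids (avoidsAt⁺ π (position k) (allowed k))) ,
                    labelled k)
        λ ρ → covered ρ)
      where
      open Growth (growth π l label)
      covered : ∀ ρ → (∃ λ p → ρ ≡ insertMax π p) × InAv basis ρ → ∃ λ k → _ × ρ ≡ insertMax π (position k)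
      covered ρ ((p , refl) , _ , avoids) =
        let k , e = complete (avoidsAt⁻ π p perm (proj₂ (avoidsAll-insertMax⁻ {π = π} {p} forbidden avoids)))
        in k , ∈-allFin k , cong (insertMax π) e

  one : Enumeration {Vec (Fin 1) 1} HasLabel (InAv basis) (normal 1 ∷ [])
  one = record
    { list     = (0F ∷ [] , normal 1) ∷ []
    ; labels   = refl
    ; sound    = (((λ { 0F 0F _ → refl }) , avoidsAll-one _ basis) , sites-one , ¬specialAt-one) ∷ []
    ; unique   = [] ∷ []
    ; complete = λ { {0F ∷ []} _ → here refl }
    }

  count : ∀ n → HasCard (InAv {suc n} basis) (permDescendants n (normal 1))
  count n = subst (HasCard (InAv basis))
    (trans (length-generation permKids (λ _ → true) n (normal 1 ∷ [])) (ℕ.+-identityʳ _))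
    (card (λ _ → true) (generations tree one n) (λ _ → id) λ _ inAv _ → (λ _ → tt) , λ _ → inAv)

-- F₁: a maximum may be inserted at the end of a decreasing prefix.

module Decreasing where

  -- A decreasing prefix excludes every pattern with an ascent to the left of its 4. The conditions
  -- on the witnesses `a` and `b` compute to the unit type on literals and are then filled in
  -- automatically.
  avoidsPrefix : ∀ {n} {π : Vec (Fin n) n} {p} → Prefix _>_ π (toℕ p) → ∀ (q : Fin 4) (σ : Vec (Fin 3) 3) a b →
                 {_ : T (toℕ a <ᵇ toℕ b)} {_ : T (σ ! a <ᵇ σ ! b)} {_ : T (toℕ b <ᵇ toℕ q)} → ¬ ContainsAt π p σ q
  avoidsPrefix pre q σ a b {a<b} {rise} {b<q} (ι , (mono , iso) , gap) =
    <-asym (pre (ι a) (ι b) (mono a b (<ᵇ⇒< _ _ a<b)) (from (gap b) (<ᵇ⇒< _ _ b<q))) (proj₂ (iso a b) (<ᵇ⇒< _ _ rise))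

  -- Every pattern of length three except 321 is barred in front of a final 4, so three or more
  -- entries before the maximum must decrease. The remaining pattern 1243 governs the case of two
  -- entries.
  forbidden : List PatternAt
  forbidden = (3F , ⟨123⟩) ∷ (2F , ⟨123⟩) ∷ (3F , ⟨132⟩) ∷ (3F , ⟨213⟩) ∷ (3F , ⟨231⟩) ∷ (3F , ⟨312⟩) ∷ []

  module _ {n} (π : Vec (Fin n) n) (p : Fin (suc n)) where

    avoids⁺ : Prefix _>_ π (toℕ p) ⊎ SpecialAt 2 1 π p → AvoidsAllAt π p forbidden
    avoids⁺ (inj₁ pre) =
      excluded 3F ⟨123⟩ 0F 1F , excluded 2F ⟨123⟩ 0F 1F , excluded 3F ⟨132⟩ 0F 1F ,
      excluded 3F ⟨213⟩ 0F 2F , excluded 3F ⟨231⟩ 0F 1F , excluded 3F ⟨312⟩ 1F 2F , tt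
      where excluded = avoidsPrefix {π = π} {p} pre
    avoids⁺ (inj₂ (p≡2 , _ , i , i≡1 , max)) =
      small ⟨123⟩ , ¬1243 , small ⟨132⟩ , small ⟨213⟩ , small ⟨231⟩ , small ⟨312⟩ , tt
      where
      small : ∀ σ → ¬ ContainsAt π p σ 3F
      small σ = ¬containsAt-2 {π = π} {p} σ p≡2
      ¬1243 : ¬ ContainsAt π p ⟨123⟩ 2F
      ¬1243 (ι , (mono , iso) , gap) with toℕ-injective (trans (proj₂ (below-two (mono 0F 1F (s≤s z≤n)) (from (gap 1F) ≤-refl) p≡2)) (sym i≡1))
      ... | refl = max≮ {π = π} {ι 1F} {ι 2F} max (proj₂ (iso 1F 2F) (s≤s (s≤s z≤n)))

    avoids⁻ : IsPerm π → AvoidsAllAt π p forbidden → Prefix _>_ π (toℕ p) ⊎ SpecialAt 2 1 π p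
    avoids⁻ perm (¬1234 , ¬1243 , ¬1324 , ¬2134 , ¬2314 , ¬3124 , _) with ℕ.<-cmp (toℕ p) 2
    ... | tri< p<2 _ _ = inj₁ (prefix-≤1 {_>_} {π = π} (s≤s⁻¹ p<2))
    ... | tri> _ _ 2<p = inj₁ (prefix-≥3 {_>_} {π = π} 2<p (s≤s⁻¹ (toℕ<n p)) triples)
      where
      triples : ∀ i j k → toℕ i < toℕ j → toℕ j < toℕ k → toℕ k < toℕ p → π ! i > π ! j × π ! j > π ! k × π ! i > π ! k
      triples i j k i<j j<k k<p with classify {π = π} perm i<j j<k
      ... | _ , s@(s123 _ _) = ⊥-elim (¬1234 (at3 {π = π} {p} i<j j<k k<p s))
      ... | _ , s@(s132 _ _) = ⊥-elim (¬1324 (at3 {π = π} {p} i<j j<k k<p s))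
      ... | _ , s@(s213 _ _) = ⊥-elim (¬2134 (at3 {π = π} {p} i<j j<k k<p s))
      ... | _ , s@(s231 _ _) = ⊥-elim (¬2314 (at3 {π = π} {p} i<j j<k k<p s))
      ... | _ , s@(s312 _ _) = ⊥-elim (¬3124 (at3 {π = π} {p} i<j j<k k<p s))
      ... | _ , s321 k<j j<i = j<i , k<j , <-trans k<j j<i
    ... | tri≈ _ p≡2 _ = prefix-or-special {_>_} {π = π} p≡2 split
      where
      split : ∀ {x y} → toℕ x ≡ 0 → toℕ y ≡ 1 → π ! x > π ! y ⊎ Max π 1
      split {x} {y} x≡0 y≡1 with compare-< {π = π} perm {x} {y} (subst₂ _<_ (sym x≡0) (sym y≡1) ≤-refl)
      ... | inj₂ fall = inj₁ fall
      -- An entry beyond the first two and above the top of this ascent would complete 1243 with the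
      -- inserted maximum, so that top is the old maximum.
      ... | inj₁ rise = inj₂ (y , y≡1 , greatest⇒max {π = π} perm greatest)
        where
        greatest : ∀ k → k ≢ y → π ! k < π ! y
        greatest k k≢y with zero-or-one x≡0 y≡1 k
        ... | inj₁ refl        = rise
        ... | inj₂ (inj₁ k≡y)  = ⊥-elim (k≢y k≡y)
        ... | inj₂ (inj₂ 2≤k) with compare {π = π} perm k y k≢y
        ...   | inj₁ lt = lt
        ...   | inj₂ gt = ⊥-elim (¬1243 (at2 {π = π} {p} (subst₂ _<_ (sym x≡0) (sym y≡1) ≤-refl) (subst₂ _<_ (sym y≡1) (sym p≡2) ≤-refl)
                                          (subst (_≤ toℕ k) (sym p≡2) 2≤k) (s123 rise gt)))

  siteAt : ℕ → ℕ → ℕ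
  siteAt m k with k <? m
  ... | yes _ = suc k
  ... | no  _ = 0

  -- Position 0 comes last, so that inserting at the k-th site leaves exactly k + 2 sites.
  siteAt-cases : ∀ {m k} → k ≤ m → (k < m × siteAt m k ≡ suc k) ⊎ (k ≡ m × siteAt m k ≡ 0)
  siteAt-cases {m} {k} k≤m with k <? m
  ... | yes k<m = inj₁ (k<m , refl)
  ... | no  k≮m = inj₂ (≤-antisym k≤m (≮⇒≥ k≮m) , refl)

  siteAt-≤ : ∀ {m k} → k ≤ m → siteAt m k ≤ m
  siteAt-≤ {m} {k} k≤m with siteAt-cases k≤m
  ... | inj₁ (k<m , e) = subst (_≤ m) (sym e) k<m
  ... | inj₂ (_   , e) = subst (_≤ m) (sym e) z≤n

  siteAt-injective : ∀ {m j k} → j ≤ m → k ≤ m → siteAt m j ≡ siteAt m k → j ≡ k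
  siteAt-injective j≤m k≤m e with siteAt-cases j≤m | siteAt-cases k≤m
  ... | inj₁ (_ , x) | inj₁ (_ , y) = ℕ.suc-injective (trans (sym x) (trans e y))
  ... | inj₁ (_ , x) | inj₂ (_ , y) with () ← trans (sym x) (trans e y)
  ... | inj₂ (_ , x) | inj₁ (_ , y) with () ← trans (sym x) (trans e y)
  ... | inj₂ (x , _) | inj₂ (y , _) = trans x (sym y)

  siteAt-surjective : ∀ {m c} → c ≤ m → ∃ λ k → k ≤ m × c ≡ siteAt m k
  siteAt-surjective {m} {zero} _ with siteAt-cases {m} {m} ≤-refl
  ... | inj₁ (m<m , _) = ⊥-elim (<-irrefl refl m<m)
  ... | inj₂ (_ , e)   = m , ≤-refl , sym e
  siteAt-surjective {m} {suc c} c<m with siteAt-cases {m} {c} (<⇒≤ c<m)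
  ... | inj₁ (_ , e)   = c , <⇒≤ c<m , sym e
  ... | inj₂ (c≡m , _) = ⊥-elim (<-irrefl c≡m c<m)

  siteAt-zero : ∀ {m} → 1 ≤ m → siteAt m 0 ≡ 1
  siteAt-zero {suc m} _ = refl

  module _ {n m} {π : Vec (Fin n) n} {p : Fin (suc n)} (s : LongestPrefix _>_ π m) where
    open LongestPrefix s

    inside : ∀ {k} → k < m → toℕ p ≡ suc k → LongestPrefix _>_ (insertMax π p) (suc k)
    inside {k} k<m e = record
      { nonempty = s≤s z≤n
      ; bounded  = s≤s (≤-trans (n≤1+n k) (≤-trans k<m bounded))
      ; holds    = prefix-insertMax⁺ {_>_} {π = π} {p} (≤-reflexive (sym e)) (prefix-mono {_>_} {π = π} k<m holds)
      -- A longer prefix would contain the first entry and, behind it, the larger inserted maximum.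
      ; longest  = λ {c} _ pre → ≮⇒≥ λ k<c →
          <-asym (pre (punchIn p x) p (old<new⁺ p x<p) (subst (_< c) (sym e) k<c)) (old<max π p x)
      }
      where
      x = fromℕ< 1≤n
      x<p : toℕ x < toℕ p
      x<p = subst₂ _<_ (sym (toℕ-fromℕ< 1≤n)) (sym e) (s≤s z≤n)

    front : toℕ p ≡ 0 → LongestPrefix _>_ (insertMax π p) (suc m)
    front e with refl ← toℕ-injective {i = p} {zero} e = record
      { nonempty = s≤s z≤n
      ; bounded  = s≤s bounded
      ; holds    = extended
      ; longest  = λ { {zero} _ _ → z≤n ; {suc c} (s≤s c≤n) pre → s≤s (longest c≤n λ i j i<j j<c →
          subst₂ _>_ (!-old π p i) (!-old π p j) (pre (suc i) (suc j) (s≤s i<j) (s≤s j<c))) }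
      }
      where
      extended : Prefix _>_ (insertMax π zero) (suc m)
      extended zero    (suc j) _   _   = old<max π p j
      extended (suc i) (suc j) i<j j<m = subst₂ _>_ (sym (!-old π p i)) (sym (!-old π p j)) (holds i j (s≤s⁻¹ i<j) (s≤s⁻¹ j<m))

    afterInsertion : ∀ {k} → k ≤ m → toℕ p ≡ siteAt m k → LongestPrefix _>_ (insertMax π p) (suc k)
    afterInsertion k≤m e with siteAt-cases k≤m
    ... | inj₁ (k<m , f)  = inside k<m (trans e f)
    ... | inj₂ (refl , f) = front (trans e f)

  ¬prefix-2 : ∀ {n} {π : Vec (Fin n) n} {p} → SpecialAt 2 1 π p → ¬ Prefix _>_ π 2
  ¬prefix-2 {π = π} (_ , 2≤n , i , i≡1 , max) pre =
    max≮ {π = π} {i} {x} max (pre x i (subst₂ _<_ (sym (toℕ-fromℕ< _)) (sym i≡1) ≤-refl) (subst (_< 2) (sym i≡1) ≤-refl))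
    where x = fromℕ< (≤-trans (s≤s z≤n) 2≤n)

  family : Family
  family = record
    { forbidden         = forbidden
    ; Normal            = Prefix _>_
    ; specialPosition   = 2
    ; maxPosition       = 1
    ; avoidsAt⁺         = avoids⁺
    ; avoidsAt⁻         = avoids⁻
    ; specialPosition≤2 = ≤-refl
    ; special≢max       = λ ()
    ; special⇒¬normal   = λ {_} {π} {p} q pre → ¬prefix-2 {π = π} {p} q (subst (Prefix _>_ π) (proj₁ q) pre)
    ; Sites             = LongestPrefix _>_
    ; sites-nonempty    = LongestPrefix.1≤n
    ; site              = λ {_} {m} _ → siteAt m
    ; site-bounded      = λ s k≤m → ≤-trans (siteAt-≤ k≤m) (LongestPrefix.bounded s)
    ; site-injective    = λ _ → siteAt-injective
    ; site-normal       = λ {_} {_} {π} s k≤m → prefix-mono {_>_} {π = π} (siteAt-≤ k≤m) (LongestPrefix.holds s)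
    ; normal-site       = λ s c≤n pre → siteAt-surjective (LongestPrefix.longest s c≤n pre)
    ; site-first        = λ s → siteAt-zero (LongestPrefix.nonempty s)
    ; sites-normal      = λ s k≤m e → afterInsertion s k≤m e
    ; sites-special     = λ {_} {π} {p} q → longestPrefix-special {π = π} {p} (proj₁ q) (¬prefix-2 {π = π} {p} q)
    ; sites-one         = longestPrefix-one
    }

-- F₂: a maximum may be inserted within an increasing prefix or at its end.

module Increasing where

  avoidsPrefix : ∀ {n} {π : Vec (Fin n) n} {p} → Prefix _<_ π (toℕ p) → ∀ (q : Fin 4) (σ : Vec (Fin 3) 3) a b →
                 {_ : T (toℕ a <ᵇ toℕ b)} {_ : T (σ ! b <ᵇ σ ! a)} {_ : T (toℕ b <ᵇ toℕ q)} → ¬ ContainsAt π p σ q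
  avoidsPrefix pre q σ a b {a<b} {fall} {b<q} (ι , (mono , iso) , gap) =
    <-asym (pre (ι a) (ι b) (mono a b (<ᵇ⇒< _ _ a<b)) (from (gap b) (<ᵇ⇒< _ _ b<q))) (proj₂ (iso b a) (<ᵇ⇒< _ _ fall))

  -- In front of a final 4 only 123 is left, which makes three or more entries increase; 2143
  -- governs the case of two entries.
  forbidden : List PatternAt
  forbidden = (3F , ⟨132⟩) ∷ (3F , ⟨213⟩) ∷ (2F , ⟨213⟩) ∷ (3F , ⟨231⟩) ∷ (3F , ⟨312⟩) ∷ (3F , ⟨321⟩) ∷ []

  module _ {n} (π : Vec (Fin n) n) (p : Fin (suc n)) where

    avoids⁺ : Prefix _<_ π (toℕ p) ⊎ SpecialAt 2 0 π p → AvoidsAllAt π p forbidden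
    avoids⁺ (inj₁ pre) =
      excluded 3F ⟨132⟩ 1F 2F , excluded 3F ⟨213⟩ 0F 1F , excluded 2F ⟨213⟩ 0F 1F ,
      excluded 3F ⟨231⟩ 0F 2F , excluded 3F ⟨312⟩ 0F 1F , excluded 3F ⟨321⟩ 0F 1F , tt
      where excluded = avoidsPrefix {π = π} {p} pre
    avoids⁺ (inj₂ (p≡2 , _ , i , i≡0 , max)) =
      small ⟨132⟩ , small ⟨213⟩ , ¬2143 , small ⟨231⟩ , small ⟨312⟩ , small ⟨321⟩ , tt
      where
      small : ∀ σ → ¬ ContainsAt π p σ 3F
      small σ = ¬containsAt-2 {π = π} {p} σ p≡2
      ¬2143 : ¬ ContainsAt π p ⟨213⟩ 2F
      ¬2143 (ι , (mono , iso) , gap) with toℕ-injective (trans (proj₁ (below-two (mono 0F 1F (s≤s z≤n)) (from (gap 1F) ≤-refl) p≡2)) (sym i≡0))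
      ... | refl = max≮ {π = π} {ι 0F} {ι 2F} max (proj₂ (iso 0F 2F) (s≤s (s≤s z≤n)))

    avoids⁻ : IsPerm π → AvoidsAllAt π p forbidden → Prefix _<_ π (toℕ p) ⊎ SpecialAt 2 0 π p
    avoids⁻ perm (¬1324 , ¬2134 , ¬2143 , ¬2314 , ¬3124 , ¬3214 , _) with ℕ.<-cmp (toℕ p) 2
    ... | tri< p<2 _ _ = inj₁ (prefix-≤1 {_<_} {π = π} (s≤s⁻¹ p<2))
    ... | tri> _ _ 2<p = inj₁ (prefix-≥3 {_<_} {π = π} 2<p (s≤s⁻¹ (toℕ<n p)) triples)
      where
      triples : ∀ i j k → toℕ i < toℕ j → toℕ j < toℕ k → toℕ k < toℕ p → π ! i < π ! j × π ! j < π ! k × π ! i < π ! k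
      triples i j k i<j j<k k<p with classify {π = π} perm i<j j<k
      ... | _ , s123 i<j j<k = i<j , j<k , <-trans i<j j<k
      ... | _ , s@(s132 _ _) = ⊥-elim (¬1324 (at3 {π = π} {p} i<j j<k k<p s))
      ... | _ , s@(s213 _ _) = ⊥-elim (¬2134 (at3 {π = π} {p} i<j j<k k<p s))
      ... | _ , s@(s231 _ _) = ⊥-elim (¬2314 (at3 {π = π} {p} i<j j<k k<p s))
      ... | _ , s@(s312 _ _) = ⊥-elim (¬3124 (at3 {π = π} {p} i<j j<k k<p s))
      ... | _ , s@(s321 _ _) = ⊥-elim (¬3214 (at3 {π = π} {p} i<j j<k k<p s))
    ... | tri≈ _ p≡2 _ = prefix-or-special {_<_} {π = π} p≡2 split
      where
      split : ∀ {x y} → toℕ x ≡ 0 → toℕ y ≡ 1 → π ! x < π ! y ⊎ Max π 0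
      split {x} {y} x≡0 y≡1 with compare-< {π = π} perm {x} {y} (subst₂ _<_ (sym x≡0) (sym y≡1) ≤-refl)
      ... | inj₁ rise = inj₁ rise
      -- An entry beyond the first two and above the top of this descent would complete 2143 with
      -- the inserted maximum, so that top is the old maximum.
      ... | inj₂ fall = inj₂ (x , x≡0 , greatest⇒max {π = π} perm greatest)
        where
        greatest : ∀ k → k ≢ x → π ! k < π ! x
        greatest k k≢x with zero-or-one x≡0 y≡1 k
        ... | inj₁ k≡x         = ⊥-elim (k≢x k≡x)
        ... | inj₂ (inj₁ refl) = fall
        ... | inj₂ (inj₂ 2≤k) with compare {π = π} perm k x k≢x
        ...   | inj₁ lt = lt
        ...   | inj₂ gt = ⊥-elim (¬2143 (at2 {π = π} {p} (subst₂ _<_ (sym x≡0) (sym y≡1) ≤-refl) (subst₂ _<_ (sym y≡1) (sym p≡2) ≤-refl)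
                                          (subst (_≤ toℕ k) (sym p≡2) 2≤k) (s213 fall gt)))

  -- The k entries in front of the maximum still increase and the maximum extends them by one;
  -- whatever follows it is smaller, so the prefix ends there.
  afterInsertion : ∀ {n m} {π : Vec (Fin n) n} (s : LongestPrefix _<_ π m) {k p} → k ≤ m → toℕ p ≡ k →
                   LongestPrefix _<_ (insertMax π p) (suc k)
  afterInsertion {n} {m} {π} s {p = p} k≤m refl = record
    { nonempty = s≤s z≤n
    ; bounded  = s≤s (≤-trans k≤m bounded)
    ; holds    = extended
    ; longest  = λ c≤ pre → ≮⇒≥ (beyond c≤ pre)
    }
    where
    open LongestPrefix s
    extended : Prefix _<_ (insertMax π p) (suc (toℕ p))
    extended i j i<j j≤p with place p i | place p j
    ... | new   | new   = ⊥-elim (<-irrefl refl i<j)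
    ... | new   | old j = ⊥-elim (<⇒≱ i<j (s≤s⁻¹ j≤p))
    ... | old i | new   = old<max π p i
    ... | old i | old j = subst₂ _<_ (sym (!-old π p i)) (sym (!-old π p j))
      (holds i j (punchIn-cancel-< p i<j) (<-≤-trans (old<new⁻ p (ℕ.≤∧≢⇒< (s≤s⁻¹ j≤p) (punchInᵢ≢i p j ∘ toℕ-injective))) k≤m))

    beyond : ∀ {c} → c ≤ suc n → Prefix _<_ (insertMax π p) c → ¬ suc (toℕ p) < c
    beyond {c} c≤ pre p<c = <-asym (pre p (punchIn p x) (new<old⁺ p (≤-reflexive (sym x≡p)))
                                     (subst (_< c) (sym (trans (punchIn-above p (≤-reflexive (sym x≡p))) (cong suc x≡p))) p<c)) (old<max π p x)
      where
      p<n : toℕ p < n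
      p<n = s≤s⁻¹ (≤-trans p<c c≤)
      x = fromℕ< p<n
      x≡p : toℕ x ≡ toℕ p
      x≡p = toℕ-fromℕ< p<n

  ¬prefix-2 : ∀ {n} {π : Vec (Fin n) n} {p} → SpecialAt 2 0 π p → ¬ Prefix _<_ π 2
  ¬prefix-2 {π = π} (_ , 2≤n , i , i≡0 , max) pre =
    max≮ {π = π} {i} {y} max (pre i y (subst₂ _<_ (sym i≡0) (sym y≡1) ≤-refl) (subst (_< 2) (sym y≡1) ≤-refl))
    where
    y = fromℕ< 2≤n
    y≡1 : toℕ y ≡ 1
    y≡1 = toℕ-fromℕ< 2≤n

  family : Family
  family = record
    { forbidden         = forbidden
    ; Normal            = Prefix _<_
    ; specialPosition   = 2
    ; maxPosition       = 0
    ; avoidsAt⁺         = avoids⁺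
    ; avoidsAt⁻         = avoids⁻
    ; specialPosition≤2 = ≤-refl
    ; special≢max       = λ ()
    ; special⇒¬normal   = λ {_} {π} {p} q pre → ¬prefix-2 {π = π} {p} q (subst (Prefix _<_ π) (proj₁ q) pre)
    ; Sites             = LongestPrefix _<_
    ; sites-nonempty    = LongestPrefix.1≤n
    ; site              = λ _ k → k
    ; site-bounded      = λ s k≤m → ≤-trans k≤m (LongestPrefix.bounded s)
    ; site-injective    = λ _ _ _ e → e
    ; site-normal       = λ {_} {_} {π} s k≤m → prefix-mono {_<_} {π = π} k≤m (LongestPrefix.holds s)
    ; normal-site       = λ s c≤n pre → _ , LongestPrefix.longest s c≤n pre , refl
    ; site-first        = λ _ → refl
    ; sites-normal      = λ s k≤m e → afterInsertion s k≤m e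
    ; sites-special     = λ {_} {π} {p} q → longestPrefix-special {π = π} {p} (proj₁ q) (¬prefix-2 {π = π} {p} q)
    ; sites-one         = longestPrefix-one
    }

-- F₃: a maximum may be inserted at a cut of a direct sum decomposition.

module DirectSum where

  -- The first c entries lie below all others, so a permutation with a cut is a direct sum with
  -- first summand of size c. The trivial cuts 0 and n are included.
  Cut : ∀ {n} → Vec (Fin n) n → ℕ → Set
  Cut π c = ∀ i k → toℕ i < c → c ≤ toℕ k → π ! i < π ! k

  avoidsCut : ∀ {n} {π : Vec (Fin n) n} {p} → Cut π (toℕ p) → ∀ (q : Fin 4) (σ : Vec (Fin 3) 3) a b →
              {_ : T (toℕ a <ᵇ toℕ q)} {_ : T (toℕ q ≤ᵇ toℕ b)} {_ : T (σ ! b <ᵇ σ ! a)} → ¬ ContainsAt π p σ q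
  avoidsCut cut q σ a b {a<q} {q≤b} {fall} (ι , (mono , iso) , gap) =
    <-asym (cut (ι a) (ι b) (from (gap a) (<ᵇ⇒< _ _ a<q)) (≮⇒≥ λ lt → <⇒≱ (to (gap b) lt) (≤ᵇ⇒≤ _ _ q≤b)))
           (proj₂ (iso b a) (<ᵇ⇒< _ _ fall))

  -- Two entries before the 4 and one after it may only form 123 or 213: both lie below the later
  -- one. One entry before the 4 and two after it may not form 213 or 231: the first entry lies
  -- below both or above both.
  forbidden : List PatternAt
  forbidden = (2F , ⟨132⟩) ∷ (2F , ⟨231⟩) ∷ (1F , ⟨213⟩) ∷ (1F , ⟨231⟩) ∷ (2F , ⟨312⟩) ∷ (2F , ⟨321⟩) ∷ []

  module _ {n} (π : Vec (Fin n) n) (p : Fin (suc n)) where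

    avoids⁺ : Cut π (toℕ p) ⊎ SpecialAt 1 0 π p → AvoidsAllAt π p forbidden
    avoids⁺ (inj₁ cut) =
      excluded 2F ⟨132⟩ 1F 2F , excluded 2F ⟨231⟩ 0F 2F , excluded 1F ⟨213⟩ 0F 1F ,
      excluded 1F ⟨231⟩ 0F 2F , excluded 2F ⟨312⟩ 0F 2F , excluded 2F ⟨321⟩ 0F 2F , tt
      where excluded = avoidsCut {π = π} {p} cut
    avoids⁺ (inj₂ (p≡1 , _ , i , i≡0 , max)) =
      small ⟨132⟩ , small ⟨231⟩ , first ⟨213⟩ 2F , first ⟨231⟩ 1F , small ⟨312⟩ , small ⟨321⟩ , tt
      where
      small : ∀ σ → ¬ ContainsAt π p σ 2F
      small σ (ι , (mono , _) , gap) =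
        <⇒≱ (subst (toℕ (ι 1F) <_) p≡1 (from (gap 1F) ≤-refl)) (≤-trans (s≤s z≤n) (mono 0F 1F (s≤s z≤n)))
      first : ∀ (σ : Vec (Fin 3) 3) b → {_ : T (σ ! 0F <ᵇ σ ! b)} → ¬ ContainsAt π p σ 1F
      first σ b {rise} (ι , (_ , iso) , gap) with toℕ-injective (trans (≤-antisym (s≤s⁻¹ (subst (toℕ (ι 0F) <_) p≡1 (from (gap 0F) ≤-refl))) z≤n) (sym i≡0))
      ... | refl = max≮ {π = π} {ι 0F} {ι b} max (proj₂ (iso 0F b) (<ᵇ⇒< _ _ rise))

    avoids⁻ : IsPerm π → AvoidsAllAt π p forbidden → Cut π (toℕ p) ⊎ SpecialAt 1 0 π p
    avoids⁻ perm (¬1342 , ¬2341 , ¬2413 , ¬2431 , ¬3142 , ¬3241 , _) with ℕ.<-cmp (toℕ p) 1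
    ... | tri< p<1 _ _ = inj₁ λ i k i<p _ → ⊥-elim (<⇒≱ (≤-<-trans z≤n i<p) (s≤s⁻¹ p<1))
    ... | tri> _ _ 1<p = inj₁ cut
      where
      pairs : ∀ i j k → toℕ i < toℕ j → toℕ j < toℕ p → toℕ p ≤ toℕ k → π ! i < π ! k × π ! j < π ! k
      pairs i j k i<j j<p p≤k with classify {π = π} perm i<j (<-≤-trans j<p p≤k)
      ... | _ , s123 i<j j<k = <-trans i<j j<k , j<k
      ... | _ , s213 j<i i<k = i<k , <-trans j<i i<k
      ... | _ , s@(s132 _ _) = ⊥-elim (¬1342 (at2 {π = π} {p} i<j j<p p≤k s))
      ... | _ , s@(s231 _ _) = ⊥-elim (¬2341 (at2 {π = π} {p} i<j j<p p≤k s))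
      ... | _ , s@(s312 _ _) = ⊥-elim (¬3142 (at2 {π = π} {p} i<j j<p p≤k s))
      ... | _ , s@(s321 _ _) = ⊥-elim (¬3241 (at2 {π = π} {p} i<j j<p p≤k s))

      2≤n : 2 ≤ n
      2≤n = ≤-trans 1<p (s≤s⁻¹ (toℕ<n p))

      cut : Cut π (toℕ p)
      -- Since 1 < p there is a second index to the left of `p`, either 0 or 1, that completes `i`
      -- and `k` to a triple.
      cut i k i<p p≤k with 0 <? toℕ i
      ... | yes 0<i = proj₂ (pairs x i k (subst (_< toℕ i) (sym (toℕ-fromℕ< _)) 0<i) i<p p≤k)
        where x = fromℕ< (≤-trans (s≤s z≤n) 2≤n)
      ... | no i≯0  = proj₁ (pairs i y k (subst (toℕ i <_) (sym (toℕ-fromℕ< _)) (s≤s (≮⇒≥ i≯0))) (subst (_< toℕ p) (sym (toℕ-fromℕ< _)) 1<p) p≤k)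
        where y = fromℕ< 2≤n
    ... | tri≈ _ p≡1 _ with 2 ≤? n
    ...   | no 2≰n = inj₁ λ i k _ p≤k → ⊥-elim (2≰n (≤-trans (s≤s (subst (_≤ toℕ k) p≡1 p≤k)) (toℕ<n k)))
    ...   | yes 2≤n = split (compare-< {π = π} perm (subst₂ _<_ (sym x≡0) (sym y≡1) ≤-refl))
      where
      x y : Fin n
      x = fromℕ< (≤-trans (s≤s z≤n) 2≤n)
      y = fromℕ< 2≤n
      x≡0 : toℕ x ≡ 0
      x≡0 = toℕ-fromℕ< _
      y≡1 : toℕ y ≡ 1
      y≡1 = toℕ-fromℕ< _
      occurs : ∀ {k σ} → 2 ≤ toℕ k → Shape (π ! x) (π ! y) (π ! k) σ → ContainsAt π p σ 1F
      occurs {k} 2≤k = at1 {π = π} {p} (subst₂ _<_ (sym x≡0) (sym p≡1) ≤-refl) (≤-reflexive (trans p≡1 (sym y≡1)))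
                         (subst (_< toℕ k) (sym y≡1) 2≤k)
      split : π ! x < π ! y ⊎ π ! y < π ! x → Cut π (toℕ p) ⊎ SpecialAt 1 0 π p
      -- With an initial ascent, any entry below the first one would complete 2431, so the first
      -- entry is the minimum and position 1 a cut.
      split (inj₁ rise) = inj₁ λ i k i<p p≤k → subst (λ i → π ! i < π ! k)
        (toℕ-injective (trans x≡0 (sym (≤-antisym (s≤s⁻¹ (subst (toℕ i <_) p≡1 i<p)) z≤n)))) (above k p≤k)
        where
        above : ∀ k → toℕ p ≤ toℕ k → π ! x < π ! k
        above k p≤k with zero-or-one x≡0 y≡1 k
        ... | inj₁ refl        = ⊥-elim (<⇒≱ (subst₂ _<_ (sym x≡0) (sym p≡1) ≤-refl) p≤k)
        ... | inj₂ (inj₁ refl) = rise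
        ... | inj₂ (inj₂ 2≤k) with compare {π = π} perm x k (λ { refl → <⇒≱ (subst₂ _<_ (sym x≡0) (sym p≡1) ≤-refl) p≤k })
        ...   | inj₁ lt = lt
        ...   | inj₂ gt = ⊥-elim (¬2431 (occurs 2≤k (s231 gt rise)))
      -- With an initial descent, any entry above the first one would complete 2413, so the first
      -- entry is the maximum.
      split (inj₂ fall) = inj₂ (p≡1 , 2≤n , x , x≡0 , greatest⇒max {π = π} perm greatest)
        where
        greatest : ∀ k → k ≢ x → π ! k < π ! x
        greatest k k≢x with zero-or-one x≡0 y≡1 k
        ... | inj₁ k≡x         = ⊥-elim (k≢x k≡x)
        ... | inj₂ (inj₁ refl) = fall
        ... | inj₂ (inj₂ 2≤k) with compare {π = π} perm k x k≢x
        ...   | inj₁ lt = lt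
        ...   | inj₂ gt = ⊥-elim (¬2413 (occurs 2≤k (s213 fall gt)))

  record Cuts {n} (π : Vec (Fin n) n) (m : ℕ) : Set where
    field
      nonempty : 1 ≤ n
      cut      : ℕ → ℕ
      bounded  : ∀ {k} → k ≤ m → cut k ≤ n
      mono     : ∀ {j k} → j < k → k ≤ m → cut j < cut k
      sound    : ∀ {k} → k ≤ m → Cut π (cut k)
      complete : ∀ {c} → c ≤ n → Cut π c → ∃ λ k → k ≤ m × c ≡ cut k

    injective : ∀ {j k} → j ≤ m → k ≤ m → cut j ≡ cut k → j ≡ k
    injective {j} {k} j≤m k≤m e with ℕ.<-cmp j k
    ... | tri< lt _ _ = ⊥-elim (<-irrefl e (mono lt k≤m))
    ... | tri≈ _ eq _ = eq
    ... | tri> _ _ gt = ⊥-elim (<-irrefl (sym e) (mono gt j≤m))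

    first : cut 0 ≡ 0
    first with complete z≤n (λ _ _ ())
    ... | zero  , _   , e = sym e
    ... | suc k , k≤m , e with () ← subst (cut 0 <_) (sym e) (mono (s≤s z≤n) k≤m)

  module _ {n} {π : Vec (Fin n) n} {p : Fin (suc n)} where

    cut-insertMax⁺ : ∀ {c} → c ≤ toℕ p → Cut π c → Cut (insertMax π p) c
    cut-insertMax⁺ {c} c≤p cut i k i<c c≤k with place p i | place p k
    ... | new   | _     = ⊥-elim (<⇒≱ i<c c≤p)
    ... | old i | new   = old<max π p i
    ... | old i | old k = subst₂ _<_ (sym (!-old π p i)) (sym (!-old π p k)) (cut i k (≤-<-trans (punchIn-increasing p i) i<c) c≤k′)
      where
      c≤k′ : c ≤ toℕ k
      c≤k′ with toℕ k <? toℕ p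
      ... | yes k<p = subst (c ≤_) (punchIn-below p k<p) c≤k
      ... | no  k≮p = ≤-trans c≤p (≮⇒≥ k≮p)

    cut-insertMax⁻ : ∀ {c} → c ≤ toℕ p → Cut (insertMax π p) c → Cut π c
    cut-insertMax⁻ c≤p cut i k i<c c≤k = subst₂ _<_ (!-old π p i) (!-old π p k)
      (cut (punchIn p i) (punchIn p k) (subst (_< _) (sym (punchIn-below p (<-≤-trans i<c c≤p))) i<c) (≤-trans c≤k (punchIn-increasing p k)))

  cut-end : ∀ {n} {π : Vec (Fin n) n} → Cut π n
  cut-end i k _ n≤k = ⊥-elim (<⇒≱ (toℕ<n k) n≤k)

  last-old : ∀ {n} (p : Fin (suc n)) → toℕ p < n → ∃ λ k → toℕ (punchIn p k) ≡ n
  last-old {suc n} p p<n = fromℕ n , trans (punchIn-above p (subst (toℕ p ≤_) (sym (toℕ-fromℕ n)) (s≤s⁻¹ p<n))) (cong suc (toℕ-fromℕ n))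

  -- A cut to the right of the maximum but before the end would put the maximum below the last
  -- entry.
  after-max⇒end : ∀ {n} {π : Vec (Fin n) n} {p c} → c ≤ suc n → toℕ p < c → Cut (insertMax π p) c → c ≡ suc n
  after-max⇒end {n} {π} {p} {c} c≤ p<c cut = ≤-antisym c≤ (≰⇒> inner)
    where
    inner : ¬ c ≤ n
    inner c≤n = let k , e = last-old p (<-≤-trans p<c c≤n) in
      <-asym (cut p (punchIn p k) p<c (subst (c ≤_) (sym e) c≤n)) (old<max π p k)

  -- Cuts number 0 to k, those up to the insertion point, survive; later ones are destroyed by the
  -- maximum in front of them, and the new end n + 1 is added. This is one cut more than the k + 1
  -- survivors even when `p` is the old end.
  afterInsertion : ∀ {n m} {π : Vec (Fin n) n} (s : Cuts π m) {k p} → k ≤ m → toℕ p ≡ Cuts.cut s k → Cuts (insertMax π p) (suc k)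
  afterInsertion {n} {m} {π} s {k} {p} k≤m p≡cut = record
    { nonempty = s≤s z≤n
    ; cut      = cut′
    ; bounded  = bounded′
    ; mono     = mono′
    ; sound    = sound′
    ; complete = complete′
    }
    where
    open Cuts s
    cut′ : ℕ → ℕ
    cut′ j with j ≤? k
    ... | yes _ = cut j
    ... | no  _ = suc n

    below-p : ∀ {j} → j ≤ k → cut j ≤ toℕ p
    below-p {j} j≤k with ℕ.m≤n⇒m<n∨m≡n j≤k
    ... | inj₁ j<k  = subst (cut j ≤_) (sym p≡cut) (<⇒≤ (mono j<k k≤m))
    ... | inj₂ refl = ≤-reflexive (sym p≡cut)

    bounded′ : ∀ {j} → j ≤ suc k → cut′ j ≤ suc n
    bounded′ {j} _ with j ≤? k
    ... | yes j≤k = ≤-trans (bounded (≤-trans j≤k k≤m)) (n≤1+n n)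
    ... | no  _   = ≤-refl

    mono′ : ∀ {i j} → i < j → j ≤ suc k → cut′ i < cut′ j
    mono′ {i} {j} i<j j≤ with i ≤? k | j ≤? k
    ... | yes _   | yes j≤k = mono i<j (≤-trans j≤k k≤m)
    ... | yes i≤k | no _    = s≤s (bounded (≤-trans i≤k k≤m))
    ... | no i≰k  | _       = ⊥-elim (i≰k (s≤s⁻¹ (≤-trans i<j j≤)))

    sound′ : ∀ {j} → j ≤ suc k → Cut (insertMax π p) (cut′ j)
    sound′ {j} _ with j ≤? k
    ... | yes j≤k = cut-insertMax⁺ {π = π} (below-p j≤k) (sound (≤-trans j≤k k≤m))
    ... | no  _   = cut-end {π = insertMax π p}

    cut′-old : ∀ {j} → j ≤ k → cut′ j ≡ cut j
    cut′-old {j} j≤k with j ≤? k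
    ... | yes _   = refl
    ... | no  j≰k = ⊥-elim (j≰k j≤k)

    cut′-end : cut′ (suc k) ≡ suc n
    cut′-end with suc k ≤? k
    ... | yes k<k = ⊥-elim (<-irrefl refl k<k)
    ... | no  _   = refl

    complete′ : ∀ {c} → c ≤ suc n → Cut (insertMax π p) c → ∃ λ j → j ≤ suc k × c ≡ cut′ j
    complete′ {c} c≤ isCut with c ≤? toℕ p
    ... | no c≰p = suc k , ≤-refl , trans (after-max⇒end {π = π} c≤ (≰⇒> c≰p) isCut) (sym cut′-end)
    ... | yes c≤p with complete (≤-trans c≤p (s≤s⁻¹ (toℕ<n p))) (cut-insertMax⁻ {π = π} c≤p isCut)
    ...   | j , j≤m , refl with j ≤? k
    ...     | yes j≤k = j , ≤-trans j≤k (n≤1+n k) , sym (cut′-old j≤k)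
    ...     | no  j≰k = ⊥-elim (<⇒≱ (mono (≰⇒> j≰k) j≤m) (subst (cut j ≤_) p≡cut c≤p))

  endpoints : ℕ → ℕ → ℕ
  endpoints n zero    = 0
  endpoints n (suc _) = n

  endpoints-cuts : ∀ {n} {π : Vec (Fin n) n} → 1 ≤ n → (∀ {c} → 1 ≤ c → c ≤ n → Cut π c → c ≡ n) → Cuts π 1
  endpoints-cuts {n} {π} 1≤n only = record
    { nonempty = 1≤n
    ; cut      = endpoints n
    ; bounded  = λ { {zero} _ → z≤n ; {suc _} _ → ≤-refl }
    ; mono     = λ { {zero} {suc _} _ _ → 1≤n ; {suc _} {suc _} (s≤s ()) (s≤s z≤n) }
    ; sound    = λ { {zero} _ _ _ () ; {suc _} _ → cut-end {π = π} }
    ; complete = λ { {zero} _ _ → 0 , z≤n , refl ; {suc c} c≤n isCut → 1 , ≤-refl , only (s≤s z≤n) c≤n isCut }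
    }

  -- The old maximum stays in front, and `2 ≤ n` makes the last entry an old one. A cut strictly
  -- inside would put the old maximum below that last entry, so only the two ends remain.
  afterSpecial : ∀ {n} {π : Vec (Fin n) n} {p} → SpecialAt 1 0 π p → Cuts (insertMax π p) 1
  afterSpecial {n} {π} {p} (p≡1 , 2≤n , i , i≡0 , max) = endpoints-cuts (s≤s z≤n) λ {c} 1≤c c≤ isCut →
    ≤-antisym c≤ (≰⇒> λ c≤n → let k , e = last-old p (subst (_< n) (sym p≡1) 2≤n) in
      max≮ {π = π} {i} {k} max (subst₂ _<_ (!-old π p i) (!-old π p k)
        (isCut (punchIn p i) (punchIn p k)
          (subst (_< c) (sym (trans (punchIn-below p (subst₂ _<_ (sym i≡0) (sym p≡1) ≤-refl)) i≡0)) 1≤c)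
          (subst (c ≤_) (sym e) c≤n))))

  ¬cut-1 : ∀ {n} {π : Vec (Fin n) n} {p} → SpecialAt 1 0 π p → ¬ Cut π 1
  ¬cut-1 {π = π} (_ , 2≤n , i , i≡0 , max) cut =
    max≮ {π = π} {i} {fromℕ< 2≤n} max (cut i _ (subst (_< 1) (sym i≡0) ≤-refl) (≤-reflexive (sym (toℕ-fromℕ< 2≤n))))

  family : Family
  family = record
    { forbidden         = forbidden
    ; Normal            = Cut
    ; specialPosition   = 1
    ; maxPosition       = 0
    ; avoidsAt⁺         = avoids⁺
    ; avoidsAt⁻         = avoids⁻
    ; specialPosition≤2 = s≤s z≤n
    ; special≢max       = λ ()
    ; special⇒¬normal   = λ {_} {π} {p} q cut → ¬cut-1 {π = π} {p} q (subst (Cut π) (proj₁ q) cut)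
    ; Sites             = Cuts
    ; sites-nonempty    = Cuts.nonempty
    ; site              = Cuts.cut
    ; site-bounded      = Cuts.bounded
    ; site-injective    = Cuts.injective
    ; site-normal       = Cuts.sound
    ; normal-site       = Cuts.complete
    ; site-first        = Cuts.first
    ; sites-normal      = λ s k≤m e → afterInsertion s k≤m e
    ; sites-special     = λ {_} {π} {p} q → afterSpecial {π = π} {p} q
    ; sites-one         = endpoints-cuts ≤-refl λ 1≤c c≤1 _ → ≤-antisym c≤1 1≤c
    }

theorem3 : ∀ (n : ℕ) → n ≥ 1 →
  let p : Fin 4 → Fin 4 → Fin 4 → Fin 4 → Vec (Fin 4) 4
      p a b c d = a ∷ b ∷ c ∷ d ∷ []
      -- pattern digits 1,2,3,4 are the values 0F,1F,2F,3F
      F₁ = p 0F 1F 2F 3F ∷ p 0F 1F 3F 2F ∷ p 0F 2F 1F 3F ∷ p 1F 0F 2F 3F ∷ p 1F 2F 0F 3F ∷ p 2F 0F 1F 3F ∷ []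
      F₂ = p 0F 2F 1F 3F ∷ p 1F 0F 2F 3F ∷ p 1F 0F 3F 2F ∷ p 1F 2F 0F 3F ∷ p 2F 0F 1F 3F ∷ p 2F 1F 0F 3F ∷ []
      F₃ = p 0F 2F 3F 1F ∷ p 1F 2F 3F 0F ∷ p 1F 3F 0F 2F ∷ p 1F 3F 2F 0F ∷ p 2F 0F 3F 1F ∷ p 2F 1F 3F 0F ∷ []
  in Σ ℕ λ k → HasCard (IsNSSim {suc n}) k ×
       HasCard (InAv {n} F₁) k × HasCard (InAv {n} F₂) k × HasCard (InAv {n} F₃) k
theorem3 (suc n) _ =
  permDescendants n (normal 1) ,
  -- The root label 0 of the one-vertex relation has the single child 1, and its count there equals
  -- that of `normal 1`, the label of the one-entry permutation. This lag of one generation is the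
  -- extra vertex on the side of the relations.
  subst (HasCard IsNSSim) (trans (ℕ.+-identityʳ _) (sym (perm≡sim n 0))) (similarity-count (suc n)) ,
  Family.count Decreasing.family n , Family.count Increasing.family n , Family.count DirectSum.family n
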